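{- Let $\eta>0$, and let $m,d$ be positive integers. Then there exists a positive integer $n_3=n_3(\eta,m,d)$ with the following property. Let $n\geqslant n_3$ be an integer, and let $Q\colon\mathbb{F}_2^{\binom{[n]}{\leqslant 2}}\to\mathbb{Z}_{2^d}$ be a $d$-integer polynomial of degree at most $d$. Then there exists a collection $\mathcal{V}$ of pairwise disjoint $m$-dimensional block $\mathrm{HJ}$-subspaces of $\mathbb{F}_2^{\binom{[n]}{\leqslant 2}}$ such that (i) $\mathbb{P}\big[\mathbb{F}_2^{\binom{[n]}{\leqslant 2}}\setminus(\bigcup\mathcal{V})\big]\leqslant\eta$, and (ii) for every $V\in\mathcal{V}$, $Q$ is constant on $V$.
   Context: $[n]=\{1,\dots,n\}$; for a finite set $A$, $\binom{A}{\leqslant r}$ is the set of nonempty subsets of $A$ with at most $r$ elements. $\mathbb{P}$ is the uniform probability measure on $\mathbb{F}_2^{\binom{[n]}{\leqslant 2}}$; $\mathbb{Z}_{2^k}=\mathbb{Z}/2^k\mathbb{Z}$. A function $Q\colon\mathbb{F}_2^{\binom{[n]}{\leqslant 2}}\to\mathbb{Z}_{2^k}$ is a $k$-integer polynomial of degree at most $d$ if $Q(x)=\alpha+\sum_{F\in\binom{\binom{[n]}{\leqslant 2}}{\leqslant d}}\lambda_F\prod_{e\in F}x(e)\bmod 2^k$ with $\alpha,\lambda_F\in\mathbb{Z}_{2^k}$ (each $x(e)$ identified with $0$ or $1$). HJ-subspaces: for $n\geqslant m$ and a sequence $\boldsymbol{I}=(I_i)_{i=1}^m$ of pairwise disjoint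 nonempty subsets of $[n]$ with $\min I_1<\dots<\min I_m$, for $q\in\binom{[m]}{\leqslant 2}$ let $b_q$ be the indicator of $\{p\in\binom{[n]}{\leqslant 2}\colon p\subseteq\bigcup_{i\in q}I_i,\ p\cap I_i\neq\emptyset\ \forall i\in q\}$ and $\mathrm{Id}_{\boldsymbol{I}}(x)=\sum_q x(q)b_q$ for $x\in\mathbb{F}_2^{\binom{[m]}{\leqslant 2}}$. An HJ-embedding is $e=\mathrm{Id}_{\boldsymbol{I}}+c$ with $c\in\mathbb{F}_2^{\binom{[n]}{\leqslant 2}}$ vanishing on $\binom{I_1\cup\dots\cup I_m}{\leqslant 2}$; it has dimension $m$ and wildcard sets $\boldsymbol{I}$. An $m$-dimensional HJ-subspace is the image of such an embedding; it is block if $\max I_i<\min I_{i+1}$ for all $i\leqslant m-1$. -}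

module Defs where

open import Data.Nat as ℕ using (ℕ; zero; suc; _+_; _*_; _^_)
open import Data.Nat.Combinatorics using (_C_)
open import Data.Fin as Fin using (Fin)
open import Data.Fin.Properties using (_≤?_)
open import Data.Nat.Properties using (m^n≢0)
open import Data.Bool using (Bool; true; false; _∧_; _∨_; _xor_; if_then_else_)
open import Data.List using (List; []; _∷_; foldr; allFin; length)
open import Data.List.Relation.Unary.All using (All)
open import Data.List.Relation.Unary.Any using (Any)
open import Data.List.Relation.Unary.AllPairs using (AllPairs)
open import Data.Product using (Σ; ∃; _×_; _,_)
open import Relation.Nullary using (¬_; yes; no)
open import Relation.Binary.PropositionalEquality using (_≡_)

-- An element of binom([n], ≤ 2): the set {lo, hi} with lo ≤ hi
-- (lo ≡ hi encodes the singleton {lo}).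
record Edge (n : ℕ) : Set where
  constructor edge
  field
    lo  : Fin n
    hi  : Fin n
    ord : lo Fin.≤ hi
open Edge public

numEdges : ℕ → ℕ
numEdges n = n + n C 2

Pt : ℕ → Set
Pt n = Edge n → Bool

_≈ₚ_ : ∀ {n} → Pt n → Pt n → Set
x ≈ₚ y = ∀ e → x e ≡ y e

-- k-integer polynomials of degree at most d (values in ℤ_{2^k}, represented
-- by their residues in ℕ). A monomial λ_F ∏_{e∈F} x(e) is given by a
-- coefficient and a list of at most d edges.

prodPt : ∀ {n} → Pt n → List (Edge n) → ℕ
prodPt x [] = 1
prodPt x (e ∷ es) = (if x e then 1 else 0) * prodPt x es

evalPoly : ∀ {n} → ℕ → List (ℕ × List (Edge n)) → Pt n → ℕ
evalPoly α mons x = foldr (λ { (c , F) acc → c * prodPt x F + acc }) α mons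

IsIntPoly : ∀ {n} (k d : ℕ) → (Pt n → ℕ) → Set
IsIntPoly {n} k d Q =
  Σ ℕ λ α → Σ (List (ℕ × List (Edge n))) λ mons →
    All (λ { (c , F) → length F ℕ.≤ d }) mons ×
    (∀ x → Q x ≡ ℕ._%_ (evalPoly α mons x) (2 ^ k) {{m^n≢0 2 k}})

bIdx : ∀ {n m} → (Fin m → Fin n → Bool) → Edge m → Edge n → Bool
bIdx I q p =
  ((I (lo q) (lo p) ∨ I (hi q) (lo p)) ∧ (I (lo q) (hi p) ∨ I (hi q) (hi p)))
  ∧ ((I (lo q) (lo p) ∨ I (lo q) (hi p)) ∧ (I (hi q) (lo p) ∨ I (hi q) (hi p)))

IdI : ∀ {n m} → (Fin m → Fin n → Bool) → Pt m → Pt n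
IdI {n} {m} I x p =
  foldr (λ i acc → foldr (λ j acc' → term i j xor acc') acc (allFin m)) false (allFin m)
  where
  term : Fin m → Fin m → Bool
  term i j with i ≤? j
  ... | yes i≤j = x (edge i j i≤j) ∧ bIdx I (edge i j i≤j) p
  ... | no _    = false

InUnion : ∀ {n m} → (Fin m → Fin n → Bool) → Fin n → Set
InUnion I a = ∃ λ i → I i a ≡ true

record BlockHJ (n m : ℕ) : Set where
  field
    I        : Fin m → Fin n → Bool
    c        : Pt n
    nonempty : ∀ i → ∃ λ a → I i a ≡ true
    disjoint : ∀ i j a → I i a ≡ true → I j a ≡ true → i ≡ j
    minOrder : ∀ i j → i Fin.< j →
               ∃ λ a → I i a ≡ true × (∀ b → I j b ≡ true → a Fin.< b)
    block    : ∀ i j → i Fin.< j → ∀ a b → I i a ≡ true → I j b ≡ true → a Fin.< b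
    cVanish  : ∀ e → InUnion I (lo e) → InUnion I (hi e) → c e ≡ false

emb : ∀ {n m} → BlockHJ n m → Pt m → Pt n
emb V x e = IdI (BlockHJ.I V) x e xor BlockHJ.c V e

_∈HJ_ : ∀ {n m} → Pt n → BlockHJ n m → Set
x ∈HJ V = ∃ λ y → emb V y ≈ₚ x

Disjoint : ∀ {n m} → BlockHJ n m → BlockHJ n m → Set
Disjoint V W = ∀ x → x ∈HJ V → x ∈HJ W → Data.Empty.⊥
  where import Data.Empty

{-# OPTIONS --safe #-}

-- Induction on the degree d. Split [n] into its first M vertices and the rest, and let z, w, y be the
-- values on the edges inside the first part, on the edges in between, and on the edges inside the rest.
-- For fixed w, each P(z, y) - P(0, y) has degree < d in y, so almost all y lie in disjoint subspaces V of
-- large dimension on which all these differences are constant, that is, P(z, y) = P(0, y) + A(z) on V.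
-- Choose a subspace U of the z-space on which A is constant. For z in U, cover the points (z, y), y in V,
-- by the tiles U × {y}; for the other z, by {z} × W, where the W come from a covering of V for P(0, -).
-- Every such round multiplies the uncovered proportion by at most about 1 - 2^-e, where e, the number of
-- edges on M vertices, does not change from round to round.
--
-- The single subspace U is found by choosing its wildcard sets one at a time, inside consecutive blocks of
-- vertices. A choice amounts to a common nontrivial zero, modulo 2^k, of polynomials in the indicator
-- variables of a subset of the block. It exists again by separating variables with the help of the
-- polynomials of lower degree, and by raising the power of two one step at a time.

module Submission where

open import Defs
open import Data.Bool using (Bool; true; false; if_then_else_; _∧_; _∨_; _xor_)
open import Data.Bool.Properties as Bool using (∧-comm; ∧-idem; ∧-identityʳ; ∧-zeroʳ; xor-identityʳ)
open import Data.Fin as Fin using (Fin; zero; suc; join; splitAt; toℕ; _↑ˡ_; _↑ʳ_)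
open import Data.Fin.Permutation using (↔⇒≡)
open import Data.Fin.Properties as Fin
  using (1↔⊤; +↔⊎; *↔×; all?; injective⇒≤; join-splitAt; splitAt-join; splitAt-↑ˡ; splitAt-↑ʳ;
         splitAt⁻¹-↑ˡ; splitAt⁻¹-↑ʳ; toℕ-↑ˡ; toℕ-↑ʳ)
open import Data.Integer as ℤ using (ℤ; +_; -[1+_]; 0ℤ; 1ℤ)
import Data.Integer.DivMod as ℤ
import Data.Integer.Properties as ℤ
import Data.Integer.Tactic.RingSolver as ℤ-Solver
open import Data.List as List
  using (List; []; _∷_; _++_; allFin; cartesianProductWith; concatMap; deduplicate; filter; foldr;
         length; lookup; map)
open import Data.List.Membership.Propositional using () renaming (_∈_ to _∈ˡ_)
open import Data.List.Membership.Propositional.Properties using (∈-allFin; ∈-lookup)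
import Data.List.Membership.Setoid.Properties as Membership
open import Data.List.Properties using (filter-notAll; length-++; length-deduplicate; length-map)
open import Data.List.Relation.Unary.All as All using (All; []; _∷_)
import Data.List.Relation.Unary.All.Properties as Allₚ
open import Data.List.Relation.Unary.AllPairs as AllPairs using (AllPairs; []; _∷_)
import Data.List.Relation.Unary.AllPairs.Properties as AllPairsₚ
open import Data.List.Relation.Unary.Any as Any using (Any; here; there; index)
import Data.List.Relation.Unary.Any.Properties as Anyₚ
import Data.List.Relation.Unary.Unique.DecSetoid.Properties as UniqueDec
open import Data.List.Relation.Unary.Unique.Propositional using (Unique)
open import Data.List.Relation.Unary.Unique.Propositional.Properties using (allFin⁺)
open import Data.Maybe as Maybe using (Maybe; just; nothing; maybe′; _>>=_)
open import Data.Maybe.Properties using (just-injective)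
open import Data.Nat as ℕ using (ℕ; zero; suc; z≤n; s≤s; _≥_; _^_; _∸_)
open import Data.Nat.Combinatorics using (nC1≡n; nCk+nC[k+1]≡[n+1]C[k+1])
  renaming (_C_ to _choose_)
import Data.Nat.DivMod as ℕ
import Data.Nat.Properties as ℕ
import Data.Nat.Tactic.RingSolver as ℕ-Solver
open import Data.Product using (Σ; ∃; ∃₂; _×_; _,_; proj₁; proj₂)
open import Data.Rational as ℚ using (ℚ; 0ℚ; mkℚ; _<_; _≤_; _*_; _/_; *<*)
import Data.Rational.Properties as ℚ
import Data.Rational.Unnormalised as ℚᵘ
import Data.Rational.Unnormalised.Properties as ℚᵘ
open import Data.Sum as Sum using (_⊎_; inj₁; inj₂; [_,_]′)
open import Data.Sum.Function.Propositional using (_⊎-↔_)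
open import Data.Unit using (⊤; tt)
import Data.Vec.Functional as Vector
open import Function using (_↔_; Inverse; _∘_; _on_; const; id; mk↔ₛ′)
open import Function.Construct.Composition using (_↔-∘_)
open import Function.Construct.Identity using (↔-id)
open import Function.Construct.Symmetry using (↔-sym)
open import Relation.Binary.Bundles using (DecSetoid)
open import Relation.Binary.PropositionalEquality
open import Relation.Nullary using (¬_; ¬?; Dec; yes; no; does; contradiction)
open import Relation.Nullary.Decidable using (dec-true; decidable-stable; map′)

private variable
  A A′ B E F : Set
  d k l m n L M N R R′ s : ℕ

-- Boolean points over a finite index set

Distinct : List (E → Bool) → Set
Distinct = AllPairs λ x y → ¬ x ≗ y

vectors : ∀ k → List (Fin k → Bool)
vectors zero    = Vector.[] ∷ []
vectors (suc k) = map (false Vector.∷_) (vectors k) ++ map (true Vector.∷_) (vectors k)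

vectors-complete : ∀ k (x : Fin k → Bool) → Any (_≗ x) (vectors k)
vectors-complete zero    x = here λ ()
vectors-complete (suc k) x with x zero in eq | vectors-complete k (x ∘ suc)
... | false | p = Anyₚ.++⁺ˡ (Anyₚ.map⁺ (Any.map (λ { h zero → sym eq ; h (suc i) → h i }) p))
... | true  | p = Anyₚ.++⁺ʳ _ (Anyₚ.map⁺ (Any.map (λ { h zero → sym eq ; h (suc i) → h i }) p))

vectors-distinct : ∀ k → Distinct (vectors k)
vectors-distinct zero    = [] ∷ []
vectors-distinct (suc k) = AllPairsₚ.++⁺ (extend false) (extend true)
  (Allₚ.map⁺ (All.universal (λ _ → Allₚ.map⁺ (All.universal (λ _ h → contradiction (h zero) λ ()) _)) _))
  where
  extend : ∀ b → Distinct (map (b Vector.∷_) (vectors k))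
  extend b = AllPairsₚ.map⁺ (AllPairs.map (λ x≠y h → x≠y (h ∘ suc)) (vectors-distinct k))

length-vectors : ∀ k → length (vectors k) ≡ 2 ^ k
length-vectors zero    = refl
length-vectors (suc k) = begin
  length (map (false Vector.∷_) (vectors k) ++ map (true Vector.∷_) (vectors k))
    ≡⟨ length-++ (map (false Vector.∷_) (vectors k)) ⟩
  length (map (false Vector.∷_) (vectors k)) ℕ.+ length (map (true Vector.∷_) (vectors k))
    ≡⟨ cong₂ ℕ._+_ (length-map _ (vectors k)) (length-map _ (vectors k)) ⟩
  length (vectors k) ℕ.+ length (vectors k)
    ≡⟨ cong₂ ℕ._+_ (length-vectors k) (trans (length-vectors k) (sym (ℕ.+-identityʳ _))) ⟩
  2 ^ suc k ∎
  where open ≡-Reasoning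

points : E ↔ Fin k → List (E → Bool)
points {k = k} ϕ = map (_∘ Inverse.to ϕ) (vectors k)

points-complete : (ϕ : E ↔ Fin k) (x : E → Bool) → Any (_≗ x) (points ϕ)
points-complete {k = k} ϕ x = Anyₚ.map⁺ (Any.map
  (λ h e → trans (h (Inverse.to ϕ e)) (cong x (Inverse.strictlyInverseʳ ϕ e)))
  (vectors-complete k (x ∘ Inverse.from ϕ)))

points-distinct : (ϕ : E ↔ Fin k) → Distinct (points ϕ)
points-distinct {k = k} ϕ = AllPairsₚ.map⁺ (AllPairs.map
  (λ {x} {y} x≠y h → x≠y λ i → trans (sym (cong x (Inverse.strictlyInverseˡ ϕ i)))
    (trans (h (Inverse.from ϕ i)) (cong y (Inverse.strictlyInverseˡ ϕ i))))
  (vectors-distinct k))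

length-points : (ϕ : E ↔ Fin k) → length (points ϕ) ≡ 2 ^ k
length-points {k = k} ϕ = trans (length-map _ (vectors k)) (length-vectors k)

-- Reduces a statement about all points to finitely many; points are compared only pointwise, so `P`
-- has to respect `≗`.
points-all : ∀ (ϕ : E ↔ Fin k) {P : (E → Bool) → Set} → (∀ {x y} → x ≗ y → P x → P y) →
             All P (points ϕ) → ∀ x → P x
points-all ϕ resp all x = All.lookupWith (λ p y≗x → resp y≗x p) all (points-complete ϕ x)

≗-dec : E ↔ Fin k → (x y : E → Bool) → Dec (x ≗ y)
≗-dec ϕ x y = map′
  (λ h e → subst (λ e → x e ≡ y e) (Inverse.strictlyInverseʳ ϕ e) (h (Inverse.to ϕ e)))
  (λ h i → h (Inverse.from ϕ i))
  (all? λ i → x (Inverse.from ϕ i) Bool.≟ y (Inverse.from ϕ i))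

distinct-lookup : {xs : List (E → Bool)} → Distinct xs → ∀ i j → lookup xs i ≗ lookup xs j → i ≡ j
distinct-lookup (_ ∷ _)    zero    zero    _ = refl
distinct-lookup (x≠ ∷ _)   zero    (suc j) h = contradiction h (All.lookup x≠ (∈-lookup j))
distinct-lookup (x≠ ∷ _)   (suc i) zero    h = contradiction (sym ∘ h) (All.lookup x≠ (∈-lookup i))
distinct-lookup (_ ∷ dist) (suc i) (suc j) h = cong suc (distinct-lookup dist i j h)

-- Pigeonhole: sending an index of `xs` to the position of a pointwise equal entry of `ys` is
-- injective, because indices with a common position carry pointwise equal entries.
distinct-length : {xs ys : List (E → Bool)} → Distinct xs → All (λ x → Any (_≗ x) ys) xs →
                  length xs ℕ.≤ length ys
distinct-length {E} {xs} {ys} dist xs⊆ys = injective⇒≤ {f = λ i → index (position i)} λ {i} {j} eq →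
  distinct-lookup dist i j (Membership.index-injective (E →-setoid Bool) (position i) (position j) eq)
  where
  position : ∀ i → Any (lookup xs i ≗_) ys
  position i = Any.map (sym ∘_) (All.lookup xs⊆ys (∈-lookup i))

-- Polynomials with 0/1 variables, and congruences modulo powers of two

infix 4 _≡_mod2^_
-- Congruence is taken over ℤ since differences of values occur. As a record it lets unification
-- recover `a`, `b` and `k`.
record _≡_mod2^_ (a b : ℤ) (k : ℕ) : Set where
  constructor by
  field
    {quotient} : ℤ
    equation   : a ≡ b ℤ.+ quotient ℤ.* (+ 2) ℤ.^ k

mod-reflexive : ∀ {a b} → a ≡ b → a ≡ b mod2^ k
mod-reflexive {k} {b = b} eq = by {quotient = 0ℤ} (trans eq (sym (ℤ.+-identityʳ b)))

mod-sym : ∀ {a b} → a ≡ b mod2^ k → b ≡ a mod2^ k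
mod-sym {k} {b = b} (by {q} refl) = by {quotient = ℤ.- q} (lemma b q ((+ 2) ℤ.^ k))
  where
  lemma : ∀ b q K → b ≡ b ℤ.+ q ℤ.* K ℤ.+ ℤ.- q ℤ.* K
  lemma = ℤ-Solver.solve-∀

mod-trans : ∀ {a b c} → a ≡ b mod2^ k → b ≡ c mod2^ k → a ≡ c mod2^ k
mod-trans {k} {c = c} (by {q} refl) (by {r} refl) = by {quotient = q ℤ.+ r} (lemma c q r ((+ 2) ℤ.^ k))
  where
  lemma : ∀ c q r K → c ℤ.+ r ℤ.* K ℤ.+ q ℤ.* K ≡ c ℤ.+ (q ℤ.+ r) ℤ.* K
  lemma = ℤ-Solver.solve-∀

mod-+ : ∀ {a b a′ b′} → a ≡ b mod2^ k → a′ ≡ b′ mod2^ k → a ℤ.+ a′ ≡ b ℤ.+ b′ mod2^ k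
mod-+ {k} {b = b} {b′ = b′} (by {q} refl) (by {r} refl) =
  by {quotient = q ℤ.+ r} (lemma b b′ q r ((+ 2) ℤ.^ k))
  where
  lemma : ∀ b b′ q r K → b ℤ.+ q ℤ.* K ℤ.+ (b′ ℤ.+ r ℤ.* K) ≡ b ℤ.+ b′ ℤ.+ (q ℤ.+ r) ℤ.* K
  lemma = ℤ-Solver.solve-∀

mod-cancel : ∀ {a b c} → a ℤ.+ c ≡ b ℤ.+ c mod2^ k → a ≡ b mod2^ k
mod-cancel {k} {a} {b} {c} (by {q} eq) =
  by {quotient = q} (trans (cancel a c) (trans (cong (ℤ._- c) eq) (lemma b c q ((+ 2) ℤ.^ k))))
  where
  cancel : ∀ a c → a ≡ a ℤ.+ c ℤ.- c
  cancel = ℤ-Solver.solve-∀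
  lemma : ∀ b c q K → b ℤ.+ c ℤ.+ q ℤ.* K ℤ.- c ≡ b ℤ.+ q ℤ.* K
  lemma = ℤ-Solver.solve-∀

mod-swap : ∀ {a b} c e → a ≡ b mod2^ k → c ℤ.+ a ℤ.+ e ≡ e ℤ.+ b ℤ.+ c mod2^ k
mod-swap {k} {b = b} c e (by {q} refl) = by {quotient = q} (lemma b c e q ((+ 2) ℤ.^ k))
  where
  lemma : ∀ b c e q K → c ℤ.+ (b ℤ.+ q ℤ.* K) ℤ.+ e ≡ e ℤ.+ b ℤ.+ c ℤ.+ q ℤ.* K
  lemma = ℤ-Solver.solve-∀

parity : ∀ q → ∃ λ r → (q ≡ r ℤ.* + 2) ⊎ (q ≡ 1ℤ ℤ.+ r ℤ.* + 2)
parity q with q ℤ.%ℕ 2 | ℤ.n%ℕd<d q 2 | ℤ.a≡a%ℕn+[a/ℕn]*n q 2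
... | 0 | _ | eq = q ℤ./ℕ 2 , inj₁ (trans eq (ℤ.+-identityˡ _))
... | 1 | _ | eq = q ℤ./ℕ 2 , inj₂ eq
... | suc (suc _) | s≤s (s≤s ()) | _

-- Either b - a or c - a is an even multiple of 2 ^ j, or both are odd multiples and then their sum is even.
mod-lift : ∀ {j a b c e} → b ≡ a mod2^ j → c ≡ a mod2^ j → e ℤ.+ a ≡ b ℤ.+ c mod2^ suc j →
           (b ≡ a mod2^ suc j) ⊎ (c ≡ a mod2^ suc j) ⊎ (e ≡ a mod2^ suc j)
mod-lift {j} {a} {e = e} (by {q} refl) (by {r} refl) (by {s} eq) with parity q | parity r
... | q′ , inj₁ refl | _ = inj₁ (by {quotient = q′} (lemma a q′ ((+ 2) ℤ.^ j)))
  where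
  lemma : ∀ a q K → a ℤ.+ q ℤ.* + 2 ℤ.* K ≡ a ℤ.+ q ℤ.* (+ 2 ℤ.* K)
  lemma = ℤ-Solver.solve-∀
... | _ | r′ , inj₁ refl = inj₂ (inj₁ (by {quotient = r′} (lemma a r′ ((+ 2) ℤ.^ j))))
  where
  lemma : ∀ a q K → a ℤ.+ q ℤ.* + 2 ℤ.* K ≡ a ℤ.+ q ℤ.* (+ 2 ℤ.* K)
  lemma = ℤ-Solver.solve-∀
... | q′ , inj₂ refl | r′ , inj₂ refl = inj₂ (inj₂ (by {quotient = 1ℤ ℤ.+ q′ ℤ.+ r′ ℤ.+ s}
  (trans (cancel e a) (trans (cong (ℤ._- a) eq) (lemma a q′ r′ s ((+ 2) ℤ.^ j))))))
  where
  cancel : ∀ e a → e ≡ e ℤ.+ a ℤ.- a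
  cancel = ℤ-Solver.solve-∀
  lemma : ∀ a q r s K →
    a ℤ.+ (1ℤ ℤ.+ q ℤ.* + 2) ℤ.* K ℤ.+ (a ℤ.+ (1ℤ ℤ.+ r ℤ.* + 2) ℤ.* K) ℤ.+ s ℤ.* (+ 2 ℤ.* K) ℤ.- a ≡
    a ℤ.+ (1ℤ ℤ.+ q ℤ.+ r ℤ.+ s) ℤ.* (+ 2 ℤ.* K)
  lemma = ℤ-Solver.solve-∀

infixr 7 _⊗_
infixl 6 _⊕_

-- The degree bound sits in the index: each `⊗` uses up one unit, and a constant has every bound. A
-- monomial may repeat variables.
data Poly (E : Set) : ℕ → Set where
  con : ℤ → Poly E d
  _⊕_ : Poly E d → Poly E d → Poly E d
  _⊗_ : E → Poly E d → Poly E (suc d)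

bit : Bool → ℤ
bit b = if b then 1ℤ else 0ℤ

⟦_⟧ : Poly E d → (E → Bool) → ℤ
⟦ con c ⟧ x = c
⟦ p ⊕ q ⟧ x = ⟦ p ⟧ x ℤ.+ ⟦ q ⟧ x
⟦ e ⊗ p ⟧ x = bit (x e) ℤ.* ⟦ p ⟧ x

⟦⟧-cong : (p : Poly E d) {x y : E → Bool} → x ≗ y → ⟦ p ⟧ x ≡ ⟦ p ⟧ y
⟦⟧-cong (con c) h = refl
⟦⟧-cong (p ⊕ q) h = cong₂ ℤ._+_ (⟦⟧-cong p h) (⟦⟧-cong q h)
⟦⟧-cong (e ⊗ p) h = cong₂ (λ b → bit b ℤ.*_) (h e) (⟦⟧-cong p h)

⟦⟧-degree-0 : (p : Poly E 0) (x y : E → Bool) → ⟦ p ⟧ x ≡ ⟦ p ⟧ y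
⟦⟧-degree-0 (con c) x y = refl
⟦⟧-degree-0 (p ⊕ q) x y = cong₂ ℤ._+_ (⟦⟧-degree-0 p x y) (⟦⟧-degree-0 q x y)

raise : Poly E d → Poly E (suc d)
raise (con c) = con c
raise (p ⊕ q) = raise p ⊕ raise q
raise (e ⊗ p) = e ⊗ raise p

⟦raise⟧ : (p : Poly E d) (x : E → Bool) → ⟦ raise p ⟧ x ≡ ⟦ p ⟧ x
⟦raise⟧ (con c) x = refl
⟦raise⟧ (p ⊕ q) x = cong₂ ℤ._+_ (⟦raise⟧ p x) (⟦raise⟧ q x)
⟦raise⟧ (e ⊗ p) x = cong (bit (x e) ℤ.*_) (⟦raise⟧ p x)

infixl 8 _⟨_⟩ _⟨_⟩²

-- Each variable becomes a constant or another variable, so the bound `d` survives. Restrictions to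
-- slices and subspaces have this form.
_⟨_⟩ : Poly E d → (E → Bool ⊎ F) → Poly F d
con c ⟨ σ ⟩ = con c
(p ⊕ q) ⟨ σ ⟩ = p ⟨ σ ⟩ ⊕ q ⟨ σ ⟩
(e ⊗ p) ⟨ σ ⟩ with σ e
... | inj₁ true  = raise (p ⟨ σ ⟩)
... | inj₁ false = con 0ℤ
... | inj₂ f     = f ⊗ (p ⟨ σ ⟩)

⟦⟨⟩⟧ : (p : Poly E d) (σ : E → Bool ⊎ F) (y : F → Bool) → ⟦ p ⟨ σ ⟩ ⟧ y ≡ ⟦ p ⟧ ([ id , y ]′ ∘ σ)
⟦⟨⟩⟧ (con c) σ y = refl
⟦⟨⟩⟧ (p ⊕ q) σ y = cong₂ ℤ._+_ (⟦⟨⟩⟧ p σ y) (⟦⟨⟩⟧ q σ y)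
⟦⟨⟩⟧ (e ⊗ p) σ y with σ e
... | inj₁ true  = trans (⟦raise⟧ (p ⟨ σ ⟩) y) (trans (⟦⟨⟩⟧ p σ y) (sym (ℤ.*-identityˡ _)))
... | inj₁ false = refl
... | inj₂ f     = cong (bit (y f) ℤ.*_) (⟦⟨⟩⟧ p σ y)

-- A variable may become a product of two variables, hence the doubled bound. This serves for edges,
-- whose coordinates depend on a vertex set through the indicators at both ends.
_⟨_⟩² : Poly E d → (E → Bool ⊎ (F × F)) → Poly F (d ℕ.* 2)
con c ⟨ σ ⟩² = con c
(p ⊕ q) ⟨ σ ⟩² = p ⟨ σ ⟩² ⊕ q ⟨ σ ⟩²
(e ⊗ p) ⟨ σ ⟩² with σ e
... | inj₁ true    = raise (raise (p ⟨ σ ⟩²))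
... | inj₁ false   = con 0ℤ
... | inj₂ (f , g) = f ⊗ (g ⊗ (p ⟨ σ ⟩²))

⟦⟨⟩²⟧ : (p : Poly E d) (σ : E → Bool ⊎ (F × F)) (y : F → Bool) →
        ⟦ p ⟨ σ ⟩² ⟧ y ≡ ⟦ p ⟧ ([ id , (λ (f , g) → y f ∧ y g) ]′ ∘ σ)
⟦⟨⟩²⟧ (con c) σ y = refl
⟦⟨⟩²⟧ (p ⊕ q) σ y = cong₂ ℤ._+_ (⟦⟨⟩²⟧ p σ y) (⟦⟨⟩²⟧ q σ y)
⟦⟨⟩²⟧ (e ⊗ p) σ y with σ e
... | inj₁ true    = trans (⟦raise⟧ (raise (p ⟨ σ ⟩²)) y)
  (trans (⟦raise⟧ (p ⟨ σ ⟩²) y) (trans (⟦⟨⟩²⟧ p σ y) (sym (ℤ.*-identityˡ _))))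
... | inj₁ false   = refl
... | inj₂ (f , g) with y f
...   | true  = trans (ℤ.*-identityˡ _) (cong (bit (y g) ℤ.*_) (⟦⟨⟩²⟧ p σ y))
...   | false = refl

zeros : E → Bool
zeros = const false

-- In P(z, y) - P(0, y) a monomial without z-variables cancels, while one with a z-variable vanishes
-- at 0 and has that variable replaced by a constant at z. So one degree is lost.
diff : (E → Bool) → Poly (E ⊎ F) (suc d) → Poly F d
diff z (con c) = con 0ℤ
diff z (p ⊕ q) = diff z p ⊕ diff z q
diff z (inj₁ e ⊗ p) = if z e then p ⟨ [ inj₁ ∘ z , inj₂ ]′ ⟩ else con 0ℤ
diff {d = zero}  z (inj₂ f ⊗ p) = con 0ℤ
diff {d = suc _} z (inj₂ f ⊗ p) = f ⊗ diff z p

⟦diff⟧ : (z : E → Bool) (p : Poly (E ⊎ F) (suc d)) (y : F → Bool) →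
         ⟦ p ⟧ [ z , y ]′ ≡ ⟦ p ⟧ [ zeros , y ]′ ℤ.+ ⟦ diff z p ⟧ y
⟦diff⟧ z (con c) y = sym (ℤ.+-identityʳ c)
⟦diff⟧ z (p ⊕ q) y = trans (cong₂ ℤ._+_ (⟦diff⟧ z p y) (⟦diff⟧ z q y))
  (lemma (⟦ p ⟧ [ zeros , y ]′) (⟦ diff z p ⟧ y) (⟦ q ⟧ [ zeros , y ]′) (⟦ diff z q ⟧ y))
  where
  lemma : ∀ a b c d → a ℤ.+ b ℤ.+ (c ℤ.+ d) ≡ a ℤ.+ c ℤ.+ (b ℤ.+ d)
  lemma = ℤ-Solver.solve-∀
⟦diff⟧ z (inj₁ e ⊗ p) y with z e
... | true  = trans (ℤ.*-identityˡ _) (trans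
  (⟦⟧-cong p λ { (inj₁ _) → refl ; (inj₂ _) → refl })
  (trans (sym (⟦⟨⟩⟧ p [ inj₁ ∘ z , inj₂ ]′ y)) (sym (ℤ.+-identityˡ _))))
... | false = refl
⟦diff⟧ {d = zero}  z (inj₂ f ⊗ p) y = trans
  (cong (bit (y f) ℤ.*_) (⟦⟧-degree-0 p _ _)) (sym (ℤ.+-identityʳ _))
⟦diff⟧ {d = suc _} z (inj₂ f ⊗ p) y = trans
  (cong (bit (y f) ℤ.*_) (⟦diff⟧ z p y)) (ℤ.*-distribˡ-+ (bit (y f)) _ _)

-- Zero sets of polynomials on the subsets of a finite set

-- A family of `M` disjoint nonempty subsets of `Fin N`, the i-th one being the set of positions
-- with letter i. `pull` turns a set of indices into the union of its members.
record Word (N M : ℕ) : Set where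
  field
    letter : Fin N → Maybe (Fin M)
    onto   : ∀ i → ∃ λ a → letter a ≡ just i
open Word

pull : ∀ {N M} → Word N M → (Fin M → Bool) → Fin N → Bool
pull ω u a = maybe′ u false (letter ω a)

pull-zeros : ∀ {N M} (ω : Word N M) → pull ω zeros ≗ zeros
pull-zeros ω a with letter ω a
... | just _  = refl
... | nothing = refl

substitution : ∀ {N M} → Word N M → Fin N → Bool ⊎ Fin M
substitution ω = maybe′ inj₂ (inj₁ false) ∘ letter ω

⟦⟧-substitution : ∀ {N M} (p : Poly (Fin N) d) (ω : Word N M) u →
                  ⟦ p ⟨ substitution ω ⟩ ⟧ u ≡ ⟦ p ⟧ (pull ω u)
⟦⟧-substitution p ω u = trans (⟦⟨⟩⟧ p (substitution ω) u) (⟦⟧-cong p pointwise)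
  where
  pointwise : [ id , u ]′ ∘ substitution ω ≗ pull ω u
  pointwise a with letter ω a
  ... | just _  = refl
  ... | nothing = refl

idʷ : ∀ {N} → Word N N
idʷ = record { letter = just ; onto = λ i → i , refl }

infixr 9 _∘ʷ_
_∘ʷ_ : ∀ {N M L} → Word N M → Word M L → Word N L
letter (ω ∘ʷ υ) a = letter ω a >>= letter υ
onto   (ω ∘ʷ υ) i with onto υ i
... | b , eq with onto ω b
...   | a , eq′ = a , trans (cong (_>>= letter υ) eq′) eq

pull-∘ : ∀ {N M L} (ω : Word N M) (υ : Word M L) u → pull (ω ∘ʷ υ) u ≗ pull ω (pull υ u)
pull-∘ ω υ u a with letter ω a
... | just _  = refl
... | nothing = refl

_◂_ : ∀ {N N′ M} → (∃ λ (z : Fin N → Bool) → ∃ λ a → z a ≡ true) → Word N′ M →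
      Word (N ℕ.+ N′) (suc M)
letter (_◂_ {N} (z , _) υ) =
  [ (λ a → if z a then just zero else nothing) , Maybe.map suc ∘ letter υ ]′ ∘ splitAt N
onto (_◂_ {N} {N′} (z , a , za) υ) zero = a ↑ˡ N′ , trans
  (cong [ _ , _ ]′ (splitAt-↑ˡ N a N′)) (cong (if_then just zero else nothing) za)
onto (_◂_ {N} {N′} (z , _) υ) (suc i) with onto υ i
... | b , eq = N ↑ʳ b , trans (cong [ _ , _ ]′ (splitAt-↑ʳ N N′ b)) (cong (Maybe.map suc) eq)

pull-◂ : ∀ {N N′ M} (z : ∃ λ (z : Fin N → Bool) → ∃ λ a → z a ≡ true) (υ : Word N′ M) u →
         pull (z ◂ υ) u ≗ [ (if u zero then proj₁ z else zeros) , pull υ (u ∘ suc) ]′ ∘ splitAt N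
pull-◂ {N} (z , _) υ u a with splitAt N a
... | inj₂ b with letter υ b
...   | just _  = refl
...   | nothing = refl
pull-◂ {N} (z , _) υ u a | inj₁ b with z b in zb | u zero in u0
...   | true  | true  = trans u0 (sym zb)
...   | true  | false = u0
...   | false | true  = sym zb
...   | false | false = refl

split : ∀ N {N′} → Poly (Fin (N ℕ.+ N′)) d → Poly (Fin N ⊎ Fin N′) d
split N p = p ⟨ inj₂ ∘ splitAt N ⟩

⟦split⟧ : ∀ N {N′} (p : Poly (Fin (N ℕ.+ N′)) d) x → ⟦ split N p ⟧ x ≡ ⟦ p ⟧ (x ∘ splitAt N)
⟦split⟧ N p x = ⟦⟨⟩⟧ p _ x

⟦split⟧-zeros : ∀ N {N′} (p : Poly (Fin (N ℕ.+ N′)) d) →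
                ⟦ split N p ⟧ [ zeros , zeros ]′ ≡ ⟦ p ⟧ zeros
⟦split⟧-zeros N p = trans (⟦split⟧ N p _) (⟦⟧-cong p pointwise)
  where
  pointwise : [ zeros , zeros ]′ ∘ splitAt N ≗ zeros
  pointwise a with splitAt N a
  ... | inj₁ _ = refl
  ... | inj₂ _ = refl

-- A finite-unions property of Folkman type for polynomials: `pull ω u` runs through all unions of
-- `M` disjoint nonempty sets, the empty union included.
Constancy : ℕ → Set
Constancy d = ∀ k M → ∃ λ N → (p : Poly (Fin N) d) →
  ∃ λ (ω : Word N M) → ∀ u → ⟦ p ⟧ (pull ω u) ≡ ⟦ p ⟧ zeros mod2^ k

-- Words are nested: the word for the first polynomial has enough letters to treat the rest of the
-- list inside it, and unions along the composite are unions along the outer word. `N` is fixed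
-- before the polynomials are known.
constancy-list : Constancy d → (as : List A) → ∀ k M → ∃ λ N → (p : A → Poly (Fin N) d) →
  ∃ λ (ω : Word N M) → All (λ a → ∀ u → ⟦ p a ⟧ (pull ω u) ≡ ⟦ p a ⟧ zeros mod2^ k) as
constancy-list constancy []       k M = M , λ _ → idʷ , []
constancy-list constancy (a ∷ as) k M with constancy-list constancy as k M
... | N , many with constancy k N
...   | N′ , one = N′ , λ p → let
    ω , const-a  = one (p a)
    υ , const-as = many (λ b → p b ⟨ substitution ω ⟩)
    composite : ∀ b u → ⟦ p b ⟨ substitution ω ⟩ ⟧ (pull υ u) ≡ ⟦ p b ⟧ (pull (ω ∘ʷ υ) u)
    composite b u = trans (⟦⟧-substitution (p b) ω (pull υ u)) (⟦⟧-cong (p b) (sym ∘ pull-∘ ω υ u))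
    zero-value : ∀ b → ⟦ p b ⟨ substitution ω ⟩ ⟧ zeros ≡ ⟦ p b ⟧ zeros
    zero-value b = trans (⟦⟧-substitution (p b) ω zeros) (⟦⟧-cong (p b) (pull-zeros ω))
  in ω ∘ʷ υ
    , (λ u → mod-trans (mod-reflexive (⟦⟧-cong (p a) (pull-∘ ω υ u))) (const-a (pull υ u)))
    ∷ All.map (λ {b} h u → subst₂ (_≡_mod2^ k) (composite b u) (zero-value b) (h u)) const-as

⟦diff⟧-cong : {z z′ : E → Bool} → z ≗ z′ → (q : Poly (E ⊎ F) (suc d)) (y : F → Bool) →
              ⟦ diff z q ⟧ y ≡ ⟦ diff z′ q ⟧ y
⟦diff⟧-cong {z = z} {z′} h q y = begin
  ⟦ diff z q ⟧ y
    ≡⟨ difference (⟦diff⟧ z q y) ⟩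
  ⟦ q ⟧ [ z , y ]′ ℤ.- ⟦ q ⟧ [ zeros , y ]′
    ≡⟨ cong (ℤ._- _) (⟦⟧-cong q λ { (inj₁ e) → h e ; (inj₂ _) → refl }) ⟩
  ⟦ q ⟧ [ z′ , y ]′ ℤ.- ⟦ q ⟧ [ zeros , y ]′
    ≡⟨ sym (difference (⟦diff⟧ z′ q y)) ⟩
  ⟦ diff z′ q ⟧ y ∎
  where
  open ≡-Reasoning
  lemma : ∀ b c → c ≡ b ℤ.+ c ℤ.- b
  lemma = ℤ-Solver.solve-∀
  difference : ∀ {a b c} → a ≡ b ℤ.+ c → c ≡ a ℤ.- b
  difference {b = b} {c} refl = lemma b c

-- Both sides consist of the values at (zeros, x) and (zeros, y) and one value of `diff z q`, at `x`
-- on the left and at `y` on the right.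
exchange : (q : Poly (E ⊎ F) (suc d)) (z : E → Bool) (x y : F → Bool) →
           ⟦ diff z q ⟧ x ≡ ⟦ diff z q ⟧ y mod2^ k →
           ⟦ q ⟧ [ z , x ]′ ℤ.+ ⟦ q ⟧ [ zeros , y ]′ ≡ ⟦ q ⟧ [ z , y ]′ ℤ.+ ⟦ q ⟧ [ zeros , x ]′ mod2^ k
exchange {k = k} q z x y h = subst₂
  (λ a b → a ℤ.+ ⟦ q ⟧ [ zeros , y ]′ ≡ b ℤ.+ ⟦ q ⟧ [ zeros , x ]′ mod2^ k)
  (sym (⟦diff⟧ z q x)) (sym (⟦diff⟧ z q y)) (mod-swap (⟦ q ⟧ [ zeros , x ]′) (⟦ q ⟧ [ zeros , y ]′) h)

-- There are only 2^N differences `diff z q`, all of degree at most `d`, so a single word makes them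
-- all constant. On its unions `q` is then a function of `z` plus a function of the union.
separate : Constancy d → ∀ N k M → ∃ λ N′ → (q : Poly (Fin N ⊎ Fin N′) (suc d)) →
  ∃ λ (ω : Word N′ M) → ∀ z u →
    ⟦ q ⟧ [ z , pull ω u ]′ ℤ.+ ⟦ q ⟧ [ zeros , zeros ]′ ≡
    ⟦ q ⟧ [ z , zeros ]′ ℤ.+ ⟦ q ⟧ [ zeros , pull ω u ]′ mod2^ k
separate {d} constancy N k M with constancy-list constancy (points (↔-id (Fin N))) k M
... | N′ , many = N′ , separated
  where
  separated : ∀ q → ∃ λ (ω : Word N′ M) → ∀ z u →
    ⟦ q ⟧ [ z , pull ω u ]′ ℤ.+ ⟦ q ⟧ [ zeros , zeros ]′ ≡
    ⟦ q ⟧ [ z , zeros ]′ ℤ.+ ⟦ q ⟧ [ zeros , pull ω u ]′ mod2^ k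
  separated q with many (λ z → diff z q)
  ... | ω , constant = ω , λ z u → exchange q z (pull ω u) zeros (all-constant z u)
    where
    all-constant : ∀ z u → ⟦ diff z q ⟧ (pull ω u) ≡ ⟦ diff z q ⟧ zeros mod2^ k
    all-constant = points-all (↔-id (Fin N))
      (λ h c u → subst₂ (_≡_mod2^ k) (⟦diff⟧-cong h q (pull ω u)) (⟦diff⟧-cong h q zeros) (c u)) constant

Nonzero : ℕ → Set
Nonzero d = ∀ k → ∃ λ N → (p : Poly (Fin N) d) →
  ∃ λ ((u , _) : ∃ λ (u : Fin N → Bool) → ∃ λ a → u a ≡ true) → ⟦ p ⟧ u ≡ ⟦ p ⟧ zeros mod2^ k

restrictˡ : ∀ {N N′} → Poly (Fin N ⊎ Fin N′) d → Poly (Fin N) d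
restrictˡ q = q ⟨ [ inj₂ , const (inj₁ false) ]′ ⟩

⟦restrictˡ⟧ : ∀ {N N′} (q : Poly (Fin N ⊎ Fin N′) d) z → ⟦ restrictˡ q ⟧ z ≡ ⟦ q ⟧ [ z , zeros ]′
⟦restrictˡ⟧ q z = trans (⟦⟨⟩⟧ q _ z) (⟦⟧-cong q λ { (inj₁ _) → refl ; (inj₂ _) → refl })

⟦restrictˡ⟧-zeros : ∀ {N N′} (q : Poly (Fin N ⊎ Fin N′) d) →
                    ⟦ restrictˡ q ⟧ zeros ≡ ⟦ q ⟧ [ zeros , zeros ]′
⟦restrictˡ⟧-zeros q = ⟦restrictˡ⟧ q zeros

restrictʳ : ∀ {N N′ M} → Word N′ M → Poly (Fin N ⊎ Fin N′) d → Poly (Fin M) d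
restrictʳ ω q = q ⟨ [ const (inj₁ false) , inj₂ ]′ ⟩ ⟨ substitution ω ⟩

⟦restrictʳ⟧ : ∀ {N N′ M} (ω : Word N′ M) (q : Poly (Fin N ⊎ Fin N′) d) u →
              ⟦ restrictʳ ω q ⟧ u ≡ ⟦ q ⟧ [ zeros , pull ω u ]′
⟦restrictʳ⟧ ω q u = trans (⟦⟧-substitution (q ⟨ _ ⟩) ω u) (trans (⟦⟨⟩⟧ q _ (pull ω u))
  (⟦⟧-cong q λ { (inj₁ _) → refl ; (inj₂ _) → refl }))

⟦restrictʳ⟧-zeros : ∀ {N N′ M} (ω : Word N′ M) (q : Poly (Fin N ⊎ Fin N′) d) →
                    ⟦ restrictʳ ω q ⟧ zeros ≡ ⟦ q ⟧ [ zeros , zeros ]′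
⟦restrictʳ⟧-zeros ω q = trans (⟦restrictʳ⟧ ω q zeros)
  (⟦⟧-cong q λ { (inj₁ _) → refl ; (inj₂ a) → pull-zeros ω a })

-- Induction on `k`. Two separated blocks each contain a nonempty set with the value of the empty
-- set modulo 2^k. If neither has it modulo 2^(k+1), both miss by odd multiples of 2^k, and the
-- misses cancel on the union.
nonzero : Constancy d → Nonzero (suc d)
nonzero constancy zero = 1 , λ p → (const true , zero , refl) , 
  by {quotient = ⟦ p ⟧ (const true) ℤ.- ⟦ p ⟧ zeros} (lemma (⟦ p ⟧ (const true)) (⟦ p ⟧ zeros))
  where
  lemma : ∀ a b → a ≡ b ℤ.+ (a ℤ.- b) ℤ.* 1ℤ
  lemma = ℤ-Solver.solve-∀
nonzero {d} constancy (suc k) with nonzero constancy k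
-- Separation is needed modulo 2^(k+1), and the second block keeps `N` letters so that the induction
-- hypothesis applies there too.
... | N , ih with separate constancy N (suc k) N
...   | N′ , sep = N ℕ.+ N′ , root
  where
  Root : Poly (Fin (N ℕ.+ N′)) (suc d) → Set
  Root p = ∃ λ ((u , _) : ∃ λ (u : Fin (N ℕ.+ N′) → Bool) → ∃ λ a → u a ≡ true) →
           ⟦ p ⟧ u ≡ ⟦ p ⟧ zeros mod2^ suc k

  joined : ∀ p x c → x c ≡ true →
           ⟦ split N p ⟧ x ≡ ⟦ split N p ⟧ [ zeros , zeros ]′ mod2^ suc k → Root p
  joined p x c xc h = (x ∘ splitAt N , join N N′ c , trans (cong x (splitAt-join N N′ c)) xc) ,
    subst₂ (_≡_mod2^ suc k) (⟦split⟧ N p x) (⟦split⟧-zeros N p) h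

  root : ∀ p → Root p
  root p with sep (split N p)
  ... | ω , separated with ih (restrictˡ (split N p)) | ih (restrictʳ ω (split N p))
  ...   | (z , a , za) , z-root | (y , b , yb) , y-root
    with onto ω b
       | mod-lift
           (subst₂ (_≡_mod2^ k) (⟦restrictˡ⟧ (split N p) z) (⟦restrictˡ⟧-zeros (split N p)) z-root)
           (subst₂ (_≡_mod2^ k) (⟦restrictʳ⟧ ω (split N p) y) (⟦restrictʳ⟧-zeros ω (split N p)) y-root)
           (separated z y)
  ...     | _      | inj₁ h        = joined p [ z , zeros ]′ (inj₁ a) za h
  ...     | c , ωc | inj₂ (inj₁ h) =
    joined p [ zeros , pull ω y ]′ (inj₂ c) (trans (cong (maybe′ y false) ωc) yb) h
  ...     | _      | inj₂ (inj₂ h) = joined p [ z , pull ω y ]′ (inj₁ a) za h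

-- Induction on `M`: the first set comes from `nonzero`, the others from a second block separated
-- from it. Adding the first set changes the value by the same amount for every union of the others,
-- and this amount is 0 modulo 2^k.
constancy-suc : Constancy d → Constancy (suc d)
constancy-suc constancy k zero = 0 , λ p → idʷ , λ u → mod-reflexive (⟦⟧-cong p λ ())
constancy-suc {d} constancy k (suc M) with nonzero constancy k | constancy-suc constancy k M
... | N , root | M′ , ih with separate constancy N k M′
...   | N′ , sep = N ℕ.+ N′ , constant
  where
  constant : (p : Poly (Fin (N ℕ.+ N′)) (suc d)) →
             ∃ λ (ω : Word (N ℕ.+ N′) (suc M)) → ∀ u → ⟦ p ⟧ (pull ω u) ≡ ⟦ p ⟧ zeros mod2^ k
  constant p with sep (split N p)
  ... | ω , separated with root (restrictˡ (split N p)) | ih (restrictʳ ω (split N p))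
  ...   | z , z-root | υ , υ-constant = z ◂ (ω ∘ʷ υ) , λ u →
    subst₂ (_≡_mod2^ k) (sym (value u)) (⟦split⟧-zeros N p) (by-cases (u zero) (u ∘ suc))
    where
    q = split N p

    value : ∀ u → ⟦ p ⟧ (pull (z ◂ (ω ∘ʷ υ)) u) ≡
                  ⟦ q ⟧ [ (if u zero then proj₁ z else zeros) , pull ω (pull υ (u ∘ suc)) ]′
    value u = trans (⟦⟧-cong p (pull-◂ z (ω ∘ʷ υ) u)) (trans
      (sym (⟦split⟧ N p [ (if u zero then proj₁ z else zeros) , pull (ω ∘ʷ υ) (u ∘ suc) ]′))
      (⟦⟧-cong q λ { (inj₁ _) → refl ; (inj₂ a) → pull-∘ ω υ (u ∘ suc) a }))

    right : ∀ v → ⟦ q ⟧ [ zeros , pull ω (pull υ v) ]′ ≡ ⟦ q ⟧ [ zeros , zeros ]′ mod2^ k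
    right v = subst₂ (_≡_mod2^ k) (⟦restrictʳ⟧ ω q (pull υ v)) (⟦restrictʳ⟧-zeros ω q) (υ-constant v)

    left : ⟦ q ⟧ [ proj₁ z , zeros ]′ ≡ ⟦ q ⟧ [ zeros , zeros ]′ mod2^ k
    left = subst₂ (_≡_mod2^ k) (⟦restrictˡ⟧ q (proj₁ z)) (⟦restrictˡ⟧-zeros q) z-root

    by-cases : ∀ b v → ⟦ q ⟧ [ (if b then proj₁ z else zeros) , pull ω (pull υ v) ]′ ≡
                       ⟦ q ⟧ [ zeros , zeros ]′ mod2^ k
    by-cases false v = right v
    by-cases true  v = mod-cancel (mod-trans (separated (proj₁ z) (pull υ v)) (mod-+ left (right v)))

constancy : ∀ d → Constancy d
constancy zero    k M = M , λ p → idʷ , λ u → mod-reflexive (⟦⟧-degree-0 p _ _)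
constancy (suc d) = constancy-suc (constancy d)

-- Edges of complete graphs with loops

edge-irrelevant : {i j : Fin n} (p q : i Fin.≤ j) → edge i j p ≡ edge i j q
edge-irrelevant {i = i} {j} p q = cong (edge i j) (ℕ.≤-irrelevant p q)

pair : Fin n → Fin n → Edge n
pair i j with Fin.≤-total i j
... | inj₁ i≤j = edge i j i≤j
... | inj₂ j≤i = edge j i j≤i

pair-ordered : {i j : Fin n} (i≤j : i Fin.≤ j) → pair i j ≡ edge i j i≤j
pair-ordered {i = i} {j} i≤j with Fin.≤-total i j
... | inj₁ p   = edge-irrelevant p i≤j
... | inj₂ j≤i with Fin.≤-antisym i≤j j≤i
...   | refl = edge-irrelevant j≤i i≤j

pair-η : (e : Edge n) → pair (lo e) (hi e) ≡ e
pair-η e = pair-ordered (ord e)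

pair-symmetric : (f : Fin n → Fin n → A) → (∀ i j → f i j ≡ f j i) →
                 ∀ i j → f (lo (pair i j)) (hi (pair i j)) ≡ f i j
pair-symmetric f f-sym i j with Fin.≤-total i j
... | inj₁ _ = refl
... | inj₂ _ = f-sym j i

pair-reversed : {i j : Fin n} (i≤j : i Fin.≤ j) → pair j i ≡ edge i j i≤j
pair-reversed {i = i} {j} i≤j with Fin.≤-total j i
... | inj₂ p   = edge-irrelevant p i≤j
... | inj₁ j≤i with Fin.≤-antisym i≤j j≤i
...   | refl = edge-irrelevant j≤i i≤j

pair-comm : (i j : Fin n) → pair i j ≡ pair j i
pair-comm i j with Fin.≤-total i j
... | inj₁ i≤j = sym (pair-reversed i≤j)
... | inj₂ j≤i = sym (pair-ordered j≤i)

pair-map : (f : Fin n → Fin m) → ∀ i j → pair (f (lo (pair i j))) (f (hi (pair i j))) ≡ pair (f i) (f j)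
pair-map f = pair-symmetric (λ i j → pair (f i) (f j)) λ i j → pair-comm (f i) (f j)

Part : ℕ → ℕ → Set
Part M N = Edge M ⊎ (Fin M × Fin N) ⊎ Edge N

classify : Fin M ⊎ Fin N → Fin M ⊎ Fin N → Part M N
classify (inj₁ a) (inj₁ b) = inj₁ (pair a b)
classify (inj₁ a) (inj₂ b) = inj₂ (inj₁ (a , b))
classify (inj₂ a) (inj₁ b) = inj₂ (inj₁ (b , a))
classify (inj₂ a) (inj₂ b) = inj₂ (inj₂ (pair a b))

classify-comm : (s t : Fin M ⊎ Fin N) → classify s t ≡ classify t s
classify-comm (inj₁ a) (inj₁ b) = cong inj₁ (pair-comm a b)
classify-comm (inj₁ a) (inj₂ b) = refl
classify-comm (inj₂ a) (inj₁ b) = refl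
classify-comm (inj₂ a) (inj₂ b) = cong (inj₂ ∘ inj₂) (pair-comm a b)

part : ∀ M → Edge (M ℕ.+ N) → Part M N
part M e = classify (splitAt M (lo e)) (splitAt M (hi e))

unpart : Part M N → Edge (M ℕ.+ N)
unpart {N = N} (inj₁ e)              = pair (lo e ↑ˡ N) (hi e ↑ˡ N)
unpart {M} {N} (inj₂ (inj₁ (a , b))) = pair (a ↑ˡ N) (M ↑ʳ b)
unpart {M}     (inj₂ (inj₂ e))       = pair (M ↑ʳ lo e) (M ↑ʳ hi e)

unpart-classify : (s t : Fin M ⊎ Fin N) → unpart (classify s t) ≡ pair (join M N s) (join M N t)
unpart-classify {N = N} (inj₁ a) (inj₁ b) = pair-map (_↑ˡ N) a b
unpart-classify (inj₁ a) (inj₂ b) = refl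
unpart-classify (inj₂ a) (inj₁ b) = pair-comm _ _
unpart-classify {M} (inj₂ a) (inj₂ b) = pair-map (M ↑ʳ_) a b

part-pair : (s t : Fin M ⊎ Fin N) → part M (pair (join M N s) (join M N t)) ≡ classify s t
part-pair {M} {N} s t = trans
  (pair-symmetric (λ a b → classify (splitAt M a) (splitAt M b))
    (λ a b → classify-comm (splitAt M a) (splitAt M b)) (join M N s) (join M N t))
  (cong₂ classify (splitAt-join M N s) (splitAt-join M N t))

Edge-↔-Part : ∀ M → Edge (M ℕ.+ N) ↔ Part M N
Edge-↔-Part {N} M = mk↔ₛ′ (part M) unpart
  (λ { (inj₁ e)              → trans (part-pair (inj₁ (lo e)) (inj₁ (hi e))) (cong inj₁ (pair-η e))
     ; (inj₂ (inj₁ (a , b))) → part-pair (inj₁ a) (inj₂ b)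
     ; (inj₂ (inj₂ e))       → trans (part-pair (inj₂ (lo e)) (inj₂ (hi e))) (cong (inj₂ ∘ inj₂) (pair-η e)) })
  (λ e → trans (unpart-classify (splitAt M (lo e)) (splitAt M (hi e)))
    (trans (cong₂ pair (join-splitAt M N (lo e)) (join-splitAt M N (hi e))) (pair-η e)))

-- Pascal's rule, arranged as the loop at one vertex, the edges from it to the others, and the
-- remaining edges.
numEdges-suc : ∀ n → numEdges (suc n) ≡ 1 ℕ.+ (1 ℕ.* n ℕ.+ numEdges n)
numEdges-suc n = cong suc (begin
  n ℕ.+ suc n choose 2              ≡⟨ cong (n ℕ.+_) (sym (nCk+nC[k+1]≡[n+1]C[k+1] n 1)) ⟩
  n ℕ.+ (n choose 1 ℕ.+ n choose 2)      ≡⟨ cong (λ c → n ℕ.+ (c ℕ.+ n choose 2)) (nC1≡n n) ⟩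
  n ℕ.+ numEdges n             ≡⟨ cong (ℕ._+ numEdges n) (sym (ℕ.*-identityˡ n)) ⟩
  1 ℕ.* n ℕ.+ numEdges n       ∎)
  where open ≡-Reasoning

Part-↔-Fin : ∀ {a b} → Edge M ↔ Fin a → Edge N ↔ Fin b → Part M N ↔ Fin (a ℕ.+ (M ℕ.* N ℕ.+ b))
Part-↔-Fin ϕ ψ = ↔-sym +↔⊎ ↔-∘ (ϕ ⊎-↔ (↔-sym +↔⊎ ↔-∘ (↔-sym *↔× ⊎-↔ ψ)))

Edge-1-↔-Fin : Edge 1 ↔ Fin 1
Edge-1-↔-Fin = mk↔ₛ′ (const zero) (const (edge zero zero z≤n)) (λ { zero → refl })
  λ { (edge zero zero z≤n) → refl ; (edge zero (suc ()) _) ; (edge (suc ()) _ _) }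

Edge-↔-Fin : ∀ n → Edge n ↔ Fin (numEdges n)
Edge-↔-Fin zero    = mk↔ₛ′ (λ ()) (λ ()) (λ ()) (λ ())
Edge-↔-Fin (suc n) = subst (λ k → Edge (suc n) ↔ Fin k) (sym (numEdges-suc n))
  (Part-↔-Fin Edge-1-↔-Fin (Edge-↔-Fin n) ↔-∘ Edge-↔-Part 1)

-- Both sides count the edges on `M + N` vertices, by two bijections with `Fin`.
numEdges-+ : ∀ M N → numEdges (M ℕ.+ N) ≡ numEdges M ℕ.+ (M ℕ.* N ℕ.+ numEdges N)
numEdges-+ M N = ↔⇒≡
  (Part-↔-Fin (Edge-↔-Fin M) (Edge-↔-Fin N) ↔-∘ (Edge-↔-Part M ↔-∘ ↔-sym (Edge-↔-Fin (M ℕ.+ N))))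

assemble : Pt M → (Fin M × Fin N → Bool) → Pt N → Pt (M ℕ.+ N)
assemble {M} z w y = [ z , [ w , y ]′ ]′ ∘ part M

-- HJ-subspaces

-- For the wildcard sets this is the block condition, and it also gives the order of their minima.
Monotone : Word n m → Set
Monotone ω = ∀ {a b i j} → letter ω a ≡ just i → letter ω b ≡ just j → a Fin.≤ b → i Fin.≤ j

-- Reading the letter i at the positions of the i-th wildcard set encodes the whole sequence of wildcard sets.
record HJ (n m : ℕ) : Set where
  field
    word     : Word n m
    monotone : Monotone word
    offset   : Pt n
open HJ

-- The value of an embedding at one edge, kept symbolic as a fixed bit or a coordinate of the small
-- space. The same datum serves as a substitution into polynomials.
code : Bool → Maybe (Fin m) → Maybe (Fin m) → Bool ⊎ Edge m
code c (just i) (just j) = inj₂ (pair i j)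
code c (just _) nothing  = inj₁ c
code c nothing  _        = inj₁ c

code-nothing : (c : Bool) (s : Maybe (Fin m)) → code c s nothing ≡ inj₁ c
code-nothing c (just _) = refl
code-nothing c nothing  = refl

code-comm : (c : Bool) (s t : Maybe (Fin m)) → code c s t ≡ code c t s
code-comm c (just i) (just j) = cong inj₂ (pair-comm i j)
code-comm c (just _) nothing  = refl
code-comm c nothing  (just _) = refl
code-comm c nothing  nothing  = refl

coordinates : HJ n m → Edge n → Bool ⊎ Edge m
coordinates V e = code (offset V e) (letter (word V) (lo e)) (letter (word V) (hi e))

embed : HJ n m → Pt m → Pt n
embed V y = [ id , y ]′ ∘ coordinates V

embed-cong : (V : HJ n m) {x y : Pt m} → x ≗ y → embed V x ≗ embed V y
embed-cong V h e with coordinates V e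
... | inj₁ _ = refl
... | inj₂ q = h q

coordinates-pair : (V : HJ n m) (a b : Fin n) →
  coordinates V (pair a b) ≡ code (offset V (pair a b)) (letter (word V) a) (letter (word V) b)
coordinates-pair V a b = pair-symmetric (λ i j → code (offset V (pair a b)) (letter (word V) i) (letter (word V) j))
  (λ i j → code-comm _ (letter (word V) i) (letter (word V) j)) a b

-- Every coordinate can be read off at a pair of positions carrying its two letters.
embed-injective : (V : HJ n m) {x y : Pt m} → embed V x ≗ embed V y → x ≗ y
embed-injective V {x} {y} h q with onto (word V) (lo q) | onto (word V) (hi q)
... | a , ωa | b , ωb = trans (sym (value x)) (trans (h (pair a b)) (value y))
  where
  value : ∀ x → embed V x (pair a b) ≡ x q
  value x = trans (cong [ id , x ]′ (trans (coordinates-pair V a b) (cong₂ (code _) ωa ωb))) (cong x (pair-η q))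

idʰ : HJ n n
idʰ = record { word = idʷ ; monotone = λ { refl refl a≤b → a≤b } ; offset = zeros }

infixr 9 _∘ʰ_
_∘ʰ_ : HJ n m → HJ m l → HJ n l
word     (V ∘ʰ W) = word V ∘ʷ word W
monotone (V ∘ʰ W) {a} {b} {i} {j} ωa ωb a≤b
  with letter (word V) a in ωVa | letter (word V) b in ωVb
... | just a′ | just b′ = monotone W ωa ωb (monotone V ωVa ωVb a≤b)
... | just _  | nothing = contradiction ωb λ ()
... | nothing | _       = contradiction ωa λ ()
-- An edge fixed by `V` keeps the bit of `V`; an edge that `V` sends to a coordinate fixed by `W`
-- takes the bit of `W`.
offset   (V ∘ʰ W) = embed V (offset W)

embed-∘ : (V : HJ n m) (W : HJ m l) (y : Pt l) → embed (V ∘ʰ W) y ≗ embed V (embed W y)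
embed-∘ V W y e with letter (word V) (lo e) | letter (word V) (hi e)
... | just i  | just j  = sym (cong [ id , y ]′ (coordinates-pair W i j))
... | just i  | nothing = cong [ id , y ]′ (code-nothing (offset V e) (letter (word W) i))
... | nothing | _       = refl

assemble-injective : ∀ {z z′ : Pt M} {w w′} {y y′ : Pt N} → assemble z w y ≗ assemble z′ w′ y′ →
                     z ≗ z′ × w ≗ w′ × y ≗ y′
assemble-injective {M} {N} {z} {z′} {w} {w′} {y} {y′} h =
  (λ e → on-part (inj₁ e)) , (λ c → on-part (inj₂ (inj₁ c))) , (λ e → on-part (inj₂ (inj₂ e)))
  where
  on-part : [ z , [ w , y ]′ ]′ ≗ [ z′ , [ w′ , y′ ]′ ]′
  on-part p = subst (λ p → [ z , [ w , y ]′ ]′ p ≡ [ z′ , [ w′ , y′ ]′ ]′ p)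
    (Inverse.strictlyInverseˡ (Edge-↔-Part M) p) (h (unpart p))

assemble-cong : ∀ {z z′ : Pt M} {w w′} {y y′ : Pt N} → z ≗ z′ → w ≗ w′ → y ≗ y′ →
                assemble z w y ≗ assemble z′ w′ y′
assemble-cong {M} hz hw hy e with part M e
... | inj₁ e        = hz e
... | inj₂ (inj₁ c) = hw c
... | inj₂ (inj₂ e) = hy e

disassemble : ∀ M (x : Pt (M ℕ.+ N)) →
  assemble {M} (x ∘ unpart ∘ inj₁) (x ∘ unpart {M} ∘ inj₂ ∘ inj₁) (x ∘ unpart {M} ∘ inj₂ ∘ inj₂) ≗ x
disassemble M x e = trans (lemma (part M e)) (cong x (Inverse.strictlyInverseʳ (Edge-↔-Part M) e))
  where
  lemma : [ x ∘ unpart ∘ inj₁ , [ x ∘ unpart {M} ∘ inj₂ ∘ inj₁ , x ∘ unpart {M} ∘ inj₂ ∘ inj₂ ]′ ]′ ≗ x ∘ unpart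
  lemma (inj₁ _)        = refl
  lemma (inj₂ (inj₁ _)) = refl
  lemma (inj₂ (inj₂ _)) = refl

splitAt-inj₁ : ∀ {a : Fin (M ℕ.+ N)} {i} → splitAt M a ≡ inj₁ i → toℕ a ≡ toℕ i
splitAt-inj₁ {N = N} {i = i} eq = trans (cong toℕ (sym (splitAt⁻¹-↑ˡ eq))) (toℕ-↑ˡ i N)

splitAt-inj₂ : ∀ {a : Fin (M ℕ.+ N)} {i} → splitAt M a ≡ inj₂ i → toℕ a ≡ M ℕ.+ toℕ i
splitAt-inj₂ {M} {i = i} eq = trans (cong toℕ (sym (splitAt⁻¹-↑ʳ eq))) (toℕ-↑ʳ M i)

splitAt-≤₁ : ∀ {a b : Fin (M ℕ.+ N)} {i j} → splitAt M a ≡ inj₁ i → splitAt M b ≡ inj₁ j →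
             a Fin.≤ b → i Fin.≤ j
splitAt-≤₁ p q = subst₂ ℕ._≤_ (splitAt-inj₁ p) (splitAt-inj₁ q)

splitAt-≤₂ : ∀ {a b : Fin (M ℕ.+ N)} {i j} → splitAt M a ≡ inj₂ i → splitAt M b ≡ inj₂ j →
             a Fin.≤ b → i Fin.≤ j
splitAt-≤₂ {M} p q a≤b = ℕ.+-cancelˡ-≤ M _ _ (subst₂ ℕ._≤_ (splitAt-inj₂ p) (splitAt-inj₂ q) a≤b)

splitAt-≰ : ∀ {a b : Fin (M ℕ.+ N)} {i j} → splitAt M a ≡ inj₂ i → splitAt M b ≡ inj₁ j → a Fin.≰ b
splitAt-≰ {M} {j = j} p q a≤b = ℕ.<⇒≱ (Fin.toℕ<n j)
  (ℕ.≤-trans (ℕ.m≤m+n M _) (subst₂ ℕ._≤_ (splitAt-inj₂ p) (splitAt-inj₁ q) a≤b))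

-- Tiles of the first kind: the wildcard sets lie in the first part while `w` and `y` are frozen.
left : HJ M m → (Fin M × Fin N → Bool) → Pt N → HJ (M ℕ.+ N) m
letter   (word (left {M} V w y)) = [ letter (word V) , const nothing ]′ ∘ splitAt M
onto     (word (left {M} {N = N} V w y)) i with onto (word V) i
... | a , eq = a ↑ˡ N , trans (cong [ _ , _ ]′ (splitAt-↑ˡ M a N)) eq
monotone (left {M} V w y) {a} {b} ωa ωb a≤b with splitAt M a in eqa | splitAt M b in eqb
... | inj₁ _ | inj₁ _ = monotone V ωa ωb (splitAt-≤₁ eqa eqb a≤b)
... | inj₁ _ | inj₂ _ = contradiction ωb λ ()
... | inj₂ _ | _      = contradiction ωa λ ()
offset   (left V w y) = assemble (offset V) w y

embed-left : (V : HJ M m) (w : Fin M × Fin N → Bool) (y : Pt N) (x : Pt m) →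
             embed (left V w y) x ≗ assemble (embed V x) w y
embed-left {M} V w y x e with splitAt M (lo e) | splitAt M (hi e)
... | inj₁ a | inj₁ b = sym (cong [ id , x ]′ (coordinates-pair V a b))
... | inj₁ a | inj₂ b = cong [ id , x ]′ (code-nothing _ (letter (word V) a))
... | inj₂ a | inj₁ b = refl
... | inj₂ a | inj₂ b = refl

-- Tiles of the second kind: `z` and `w` are frozen.
right : Pt M → (Fin M × Fin N → Bool) → HJ N m → HJ (M ℕ.+ N) m
letter   (word (right {M} z w V)) = [ const nothing , letter (word V) ]′ ∘ splitAt M
onto     (word (right {M} {N} z w V)) i with onto (word V) i
... | a , eq = M ↑ʳ a , trans (cong [ _ , _ ]′ (splitAt-↑ʳ M N a)) eq
monotone (right {M} z w V) {a} {b} ωa ωb a≤b with splitAt M a in eqa | splitAt M b in eqb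
... | inj₂ _ | inj₂ _ = monotone V ωa ωb (splitAt-≤₂ {M} eqa eqb a≤b)
... | inj₂ _ | inj₁ _ = contradiction ωb λ ()
... | inj₁ _ | _      = contradiction ωa λ ()
offset   (right z w V) = assemble z w (offset V)

embed-right : (z : Pt M) (w : Fin M × Fin N → Bool) (V : HJ N m) (x : Pt m) →
              embed (right z w V) x ≗ assemble z w (embed V x)
embed-right {M} z w V x e with splitAt M (lo e) | splitAt M (hi e)
... | inj₁ a | inj₁ b = refl
... | inj₁ a | inj₂ b = refl
... | inj₂ a | inj₁ b = cong [ id , x ]′ (code-nothing _ (letter (word V) a))
... | inj₂ a | inj₂ b = sym (cong [ id , x ]′ (coordinates-pair V a b))

-- Choosing the wildcard sets of a constant subspace one at a time

prepend : (∃ λ (z : Fin N → Bool) → ∃ λ a → z a ≡ true) → HJ n m → HJ (N ℕ.+ n) (suc m)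
word     (prepend z V) = z ◂ word V
monotone (prepend {N} (z , _) V) {a} {b} ωa ωb a≤b with splitAt N a in eqa | splitAt N b in eqb
monotone (prepend {N} (z , _) V) ωa ωb a≤b | inj₁ a | _ with z a
monotone (prepend {N} (z , _) V) refl ωb a≤b | inj₁ a | _ | true = z≤n
monotone (prepend {N} (z , _) V) ωa ωb a≤b | inj₂ a | inj₁ b =
  contradiction a≤b (splitAt-≰ {N} eqa eqb)
monotone (prepend {N} (z , _) V) ωa ωb a≤b | inj₂ a | inj₂ b
  with letter (word V) a in ωVa | letter (word V) b in ωVb
monotone (prepend {N} (z , _) V) refl refl a≤b | inj₂ a | inj₂ b | just i | just j =
  s≤s (monotone V ωVa ωVb (splitAt-≤₂ {N} eqa eqb a≤b))
offset   (prepend z V) = assemble zeros zeros (offset V)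

-- The values on the loop at a new vertex, on the edges joining it to the old vertices, and on the old edges.
Extended : ℕ → Set
Extended n = ⊤ ⊎ Fin n ⊎ Edge n

Extended-↔-Fin : ∀ n → Extended n ↔ Fin (1 ℕ.+ (n ℕ.+ numEdges n))
Extended-↔-Fin n = ↔-sym +↔⊎ ↔-∘ (↔-sym 1↔⊤ ⊎-↔ (↔-sym +↔⊎ ↔-∘ (↔-id (Fin n) ⊎-↔ Edge-↔-Fin n)))

-- The new vertex is blown up to the vertex set `u`. For fixed `x` each coordinate is a constant,
-- possibly times the indicator of `u` at one vertex or the product of its indicators at two.
spread : (Fin N → Bool) → (Extended n → Bool) → Pt (N ℕ.+ n)
spread u x = assemble (λ e → x (inj₁ tt) ∧ (u (lo e) ∧ u (hi e)))
  (λ (a , b) → x (inj₂ (inj₁ b)) ∧ u a) (x ∘ inj₂ ∘ inj₂)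

-- The configuration whose blow-up along the new wildcard set is the point with coordinates `y`, as
-- `embed-prepend` verifies.
extended : HJ n m → Pt (suc m) → Extended n → Bool
extended V y (inj₁ _)        = y (pair zero zero)
extended V y (inj₂ (inj₁ b)) = maybe′ (λ j → y (pair zero (suc j))) false (letter (word V) b)
extended V y (inj₂ (inj₂ e)) = embed V (λ q → y (pair (suc (lo q)) (suc (hi q)))) e

embed-prepend : (z : ∃ λ (z : Fin N → Bool) → ∃ λ a → z a ≡ true) (V : HJ n m) (y : Pt (suc m)) →
                embed (prepend z V) y ≗ spread (proj₁ z) (extended V y)
embed-prepend {N} (z , _) V y e with splitAt N (lo e) | splitAt N (hi e)
... | inj₁ a | inj₁ b = trans (loops (z a) (z b))
  (cong (y (pair zero zero) ∧_) (sym (pair-symmetric (λ a b → z a ∧ z b) (λ a b → ∧-comm (z a) (z b)) a b)))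
  where
  loops : ∀ s t → [ id , y ]′ (code false (if s then just zero else nothing) (if t then just zero else nothing))
          ≡ y (pair zero zero) ∧ (s ∧ t)
  loops true  true  with y (pair zero zero)
  ... | true  = refl
  ... | false = refl
  loops true  false = sym (∧-zeroʳ _)
  loops false t     = sym (∧-zeroʳ _)
... | inj₁ a | inj₂ b with z a | letter (word V) b
...   | true  | just j  = sym (∧-identityʳ _)
...   | true  | nothing = refl
...   | false | just j  = sym (∧-zeroʳ _)
...   | false | nothing = refl
embed-prepend {N} (z , _) V y e | inj₂ b | inj₁ a with z a | letter (word V) b
...   | true  | just j  = trans (cong y (pair-comm (suc j) zero)) (sym (∧-identityʳ _))
...   | true  | nothing = refl
...   | false | just j  = sym (∧-zeroʳ _)
...   | false | nothing = refl
embed-prepend {N} (z , _) V y e | inj₂ a | inj₂ b = trans (old (letter (word V) a) (letter (word V) b))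
  (sym (cong [ id , (λ q → y (pair (suc (lo q)) (suc (hi q)))) ]′ (coordinates-pair V a b)))
  where
  old : ∀ s t → [ id , y ]′ (code (offset V (pair a b)) (Maybe.map suc s) (Maybe.map suc t)) ≡
                [ id , (λ q → y (pair (suc (lo q)) (suc (hi q)))) ]′ (code (offset V (pair a b)) s t)
  old (just i) (just j) = cong y (sym (pair-map suc i j))
  old (just i) nothing  = refl
  old nothing  t        = refl

ConstantOn : ℕ → Poly (Edge n) d → HJ n m → Set
ConstantOn k p V = ∀ x y → ⟦ p ⟧ (embed V x) ≡ ⟦ p ⟧ (embed V y) mod2^ k

-- The symbolic form of `spread`. A coordinate linear in `u` is written as a square, so that
-- everything is a constant or a product of two indicators.
spreading : (Extended n → Bool) → Part N n → Bool ⊎ (Fin N × Fin N)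
spreading x (inj₁ e)              = if x (inj₁ tt) then inj₂ (lo e , hi e) else inj₁ false
spreading x (inj₂ (inj₁ (a , b))) = if x (inj₂ (inj₁ b)) then inj₂ (a , a) else inj₁ false
spreading x (inj₂ (inj₂ e))       = inj₁ (x (inj₂ (inj₂ e)))

spread-poly : Poly (Edge (N ℕ.+ n)) d → (Extended n → Bool) → Poly (Fin N) (d ℕ.* 2)
spread-poly {N} p x = p ⟨ inj₂ ∘ part N ⟩ ⟨ spreading x ⟩²

⟦spread-poly⟧ : (p : Poly (Edge (N ℕ.+ n)) d) (x : Extended n → Bool) (u : Fin N → Bool) →
                ⟦ spread-poly p x ⟧ u ≡ ⟦ p ⟧ (spread u x)
⟦spread-poly⟧ {N} {n} p x u = trans (⟦⟨⟩²⟧ (p ⟨ inj₂ ∘ part N ⟩) (spreading x) u)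
  (trans (⟦⟨⟩⟧ p (inj₂ ∘ part N) _) (⟦⟧-cong p (pointwise ∘ part N)))
  where
  pointwise : [ id , (λ (a , b) → u a ∧ u b) ]′ ∘ spreading x ≗
    [ (λ e → x (inj₁ tt) ∧ (u (lo e) ∧ u (hi e)))
    , [ (λ (a , b) → x (inj₂ (inj₁ b)) ∧ u a) , x ∘ inj₂ ∘ inj₂ ]′ ]′
  pointwise (inj₁ e) with x (inj₁ tt)
  ... | true  = refl
  ... | false = refl
  pointwise (inj₂ (inj₁ (a , b))) with x (inj₂ (inj₁ b))
  ... | true  = ∧-idem (u a)
  ... | false = refl
  pointwise (inj₂ (inj₂ e)) = refl

-- Induction on `m`. The new wildcard set lies in a block before the old vertices and is a common
-- root over all configurations in `Extended n`, hence for whichever subspace is found on the old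
-- vertices.
constant-subspace : ∀ d k m → ∃ λ n → (p : Poly (Edge n) d) → ∃ λ (V : HJ n m) → ConstantOn k p V
constant-subspace d k zero = 0 , λ p → idʰ , λ x y → mod-reflexive (⟦⟧-cong p λ ())
constant-subspace d k (suc m) with constant-subspace d k m
-- One letter is enough: its positions form the new wildcard set. The degree doubles because edges
-- are quadratic in vertex indicators.
... | n , ih with constancy-list (constancy (d ℕ.* 2)) (points (Extended-↔-Fin n)) k 1
...   | N , roots = N ℕ.+ n , extend
  where
  extend : (p : Poly (Edge (N ℕ.+ n)) d) → ∃ λ (V : HJ (N ℕ.+ n) (suc m)) → ConstantOn k p V
  extend p with roots (spread-poly p) | ih (p ⟨ [ const (inj₁ false) , [ const (inj₁ false) , inj₂ ]′ ]′ ∘ part N ⟩)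
  ... | ω , root | V , constant = prepend (z , z≠0) V , λ x y → mod-trans (reduce x)
    (mod-trans (constant (old x) (old y)) (mod-sym (reduce y)))
    where
    z : Fin N → Bool
    z = pull ω (const true)

    z≠0 : ∃ λ a → z a ≡ true
    z≠0 with onto ω zero
    ... | a , ωa = a , cong (maybe′ (const true) false) ωa

    p′ : Poly (Edge n) d
    p′ = p ⟨ [ const (inj₁ false) , [ const (inj₁ false) , inj₂ ]′ ]′ ∘ part N ⟩

    old : Pt (suc m) → Pt m
    old y q = y (pair (suc (lo q)) (suc (hi q)))

    z-root : ∀ x → ⟦ p ⟧ (spread z x) ≡ ⟦ p ⟧ (spread zeros x) mod2^ k
    z-root = points-all (Extended-↔-Fin n)
      (λ {x} {y} h → subst₂ (_≡_mod2^ k) (⟦⟧-cong p (spread-cong z h)) (⟦⟧-cong p (spread-cong zeros h)))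
      (All.map (λ {x} h → subst₂ (_≡_mod2^ k) (⟦spread-poly⟧ p x z) (⟦spread-poly⟧ p x zeros)
        (h (const true))) root)
      where
      spread-cong : ∀ u {x y : Extended n → Bool} → x ≗ y → spread u x ≗ spread u y
      spread-cong u h = assemble-cong (λ e → cong (_∧ _) (h (inj₁ tt)))
        (λ (a , b) → cong (_∧ u a) (h (inj₂ (inj₁ b)))) (λ e → h (inj₂ (inj₂ e)))

    vanish : ∀ x → ⟦ p ⟧ (spread zeros x) ≡ ⟦ p′ ⟧ (x ∘ inj₂ ∘ inj₂)
    vanish x = sym (trans (⟦⟨⟩⟧ p _ (x ∘ inj₂ ∘ inj₂)) (⟦⟧-cong p λ e → pointwise (part N e)))
      where
      pointwise : ∀ e → [ id , x ∘ inj₂ ∘ inj₂ ]′ ([ const (inj₁ false) , [ const (inj₁ false) , inj₂ ]′ ]′ e) ≡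
        [ (λ e → x (inj₁ tt) ∧ (false ∧ false)) , [ (λ (a , b) → x (inj₂ (inj₁ b)) ∧ false) , x ∘ inj₂ ∘ inj₂ ]′ ]′ e
      pointwise (inj₁ e)              = sym (∧-zeroʳ _)
      pointwise (inj₂ (inj₁ (a , b))) = sym (∧-zeroʳ _)
      pointwise (inj₂ (inj₂ e))       = refl

    -- Replacing `z` by the empty set keeps the value modulo 2^k and makes all edges meeting the
    -- block vanish, so only the old coordinates of `y` remain.
    reduce : ∀ y → ⟦ p ⟧ (embed (prepend (z , z≠0) V) y) ≡ ⟦ p′ ⟧ (embed V (old y)) mod2^ k
    reduce y = mod-trans (mod-reflexive (⟦⟧-cong p (embed-prepend (z , z≠0) V y)))
      (mod-trans (z-root (extended V y)) (mod-reflexive (vanish (extended V y))))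

-- Partial coverings by disjoint subspaces

_∈_ : Pt n → HJ n m → Set
x ∈ V = ∃ λ y → embed V y ≗ x

Apart : (S T : Pt n → Set) → Set
Apart S T = ∀ x y → S x → T y → ¬ x ≗ y

Separate : HJ n m → HJ n l → Set
Separate V W = ∀ x y → ¬ embed V x ≗ embed W y

separate-distinct : {V W : HJ n m} → Separate V W → Apart (_∈ V) (_∈ W)
separate-distinct V#W _ _ (x , Vx) (y , Wy) x≗y =
  V#W x y λ e → trans (Vx e) (trans (x≗y e) (sym (Wy e)))

-- Each subspace has 2^(numEdges m) points since `embed` is injective, and separate subspaces share
-- none.
packing : {Vs : List (HJ n m)} → AllPairs Separate Vs → length Vs ℕ.* 2 ^ numEdges m ℕ.≤ 2 ^ numEdges n
packing {n} {m} {Vs} separate = begin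
  length Vs ℕ.* 2 ^ numEdges m  ≡⟨ sym (count Vs) ⟩
  length (concatMap image Vs)     ≤⟨ distinct-length (distinct Vs separate)
                                       (All.universal (points-complete (Edge-↔-Fin n)) _) ⟩
  length (points (Edge-↔-Fin n))  ≡⟨ length-points (Edge-↔-Fin n) ⟩
  2 ^ numEdges n                ∎
  where
  open ℕ.≤-Reasoning

  image : HJ n m → List (Pt n)
  image V = map (embed V) (points (Edge-↔-Fin m))

  count : ∀ Vs → length (concatMap image Vs) ≡ length Vs ℕ.* 2 ^ numEdges m
  count []       = refl
  count (V ∷ Vs) = trans (length-++ (image V))
    (cong₂ ℕ._+_ (trans (length-map _ (points (Edge-↔-Fin m))) (length-points (Edge-↔-Fin m))) (count Vs))

  distinct : ∀ Vs → AllPairs Separate Vs → Distinct (concatMap image Vs)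
  distinct []       []       = []
  distinct (V ∷ Vs) (V# ∷ #) = AllPairsₚ.++⁺
    (AllPairsₚ.map⁺ (AllPairs.map (λ x≠y h → x≠y (embed-injective V h)) (points-distinct (Edge-↔-Fin m))))
    (distinct Vs #)
    (Allₚ.map⁺ (All.universal (λ x → Allₚ.concat⁺ (Allₚ.map⁺ (All.map
      (λ V#W → Allₚ.map⁺ (All.universal (V#W x) _)) V#))) _))

-- A family of pairwise disjoint subspaces of S that misses at most R / L points of S.
record Cover (Good : HJ n m → Set) (S : Pt n → Set) (L R : ℕ) : Set where
  field
    tiles    : List (HJ n m)
    good     : All Good tiles
    inside   : All (λ V → ∀ y → S (embed V y)) tiles
    disjoint : AllPairs Separate tiles
    rest     : List (Pt n)
    total    : ∀ x → S x → Any (x ∈_) tiles ⊎ Any (_≗ x) rest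
    bound    : length rest ℕ.* L ℕ.≤ R
open Cover

private variable
  Good Good′ : HJ n m → Set
  S T : Pt n → Set

singleton : (V : HJ n m) → Good V → Cover Good (_∈ V) L 0
singleton V g = record
  { tiles    = V ∷ []
  ; good     = g ∷ []
  ; inside   = (λ y → y , λ _ → refl) ∷ []
  ; disjoint = [] ∷ []
  ; rest     = []
  ; total    = λ x x∈V → inj₁ (here x∈V)
  ; bound    = z≤n
  }

all-rest : (xs : List (Pt n)) → (∀ x → S x → Any (_≗ x) xs) → Cover Good S L (length xs ℕ.* L)
all-rest xs complete = record
  { tiles    = []
  ; good     = []
  ; inside   = []
  ; disjoint = []
  ; rest     = xs
  ; total    = λ x Sx → inj₂ (complete x Sx)
  ; bound    = ℕ.≤-refl
  }

union : Apart S T → Cover Good S L R → Cover Good T L R′ →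
        Cover Good (λ x → S x ⊎ T x) L (R ℕ.+ R′)
union {L = L} {R} {R′} S#T C D = record
  { tiles    = tiles C ++ tiles D
  ; good     = Allₚ.++⁺ (good C) (good D)
  ; inside   = Allₚ.++⁺ (All.map (inj₁ ∘_) (inside C)) (All.map (inj₂ ∘_) (inside D))
  ; disjoint = AllPairsₚ.++⁺ (disjoint C) (disjoint D)
      (All.map (λ V⊆S → All.map (λ W⊆T x y → S#T _ _ (V⊆S x) (W⊆T y)) (inside D)) (inside C))
  ; rest     = rest C ++ rest D
  ; total    = λ x → [ Sum.map Anyₚ.++⁺ˡ Anyₚ.++⁺ˡ ∘ total C x
                     , Sum.map (Anyₚ.++⁺ʳ (tiles C)) (Anyₚ.++⁺ʳ (rest C)) ∘ total D x ]′
  ; bound    = begin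
      length (rest C ++ rest D) ℕ.* L               ≡⟨ cong (ℕ._* L) (length-++ (rest C)) ⟩
      (length (rest C) ℕ.+ length (rest D)) ℕ.* L   ≡⟨ ℕ.*-distribʳ-+ L (length (rest C)) (length (rest D)) ⟩
      length (rest C) ℕ.* L ℕ.+ length (rest D) ℕ.* L ≤⟨ ℕ.+-mono-≤ (bound C) (bound D) ⟩
      R ℕ.+ R′                                      ∎
  }
  where open ℕ.≤-Reasoning

-- Passes to a larger region by giving up the points `xs`. With `xs` empty it merely rewrites the
-- description of the region.
extend : (xs : List (Pt n)) → (∀ x → T x → S x ⊎ Any (_≗ x) xs) → (∀ x → S x → T x) →
         R ℕ.+ length xs ℕ.* L ℕ.≤ R′ → Cover Good S L R → Cover Good T L R′
extend {R = R} {L} {R′} xs T⊆ S⊆T bound′ C = record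
  { tiles    = tiles C
  ; good     = good C
  ; inside   = All.map (λ V⊆S y → S⊆T _ (V⊆S y)) (inside C)
  ; disjoint = disjoint C
  ; rest     = rest C ++ xs
  ; total    = λ x → [ Sum.map₂ Anyₚ.++⁺ˡ ∘ total C x , inj₂ ∘ Anyₚ.++⁺ʳ (rest C) ]′ ∘ T⊆ x
  ; bound    = begin
      length (rest C ++ xs) ℕ.* L               ≡⟨ cong (ℕ._* L) (length-++ (rest C)) ⟩
      (length (rest C) ℕ.+ length xs) ℕ.* L     ≡⟨ ℕ.*-distribʳ-+ L (length (rest C)) (length xs) ⟩
      length (rest C) ℕ.* L ℕ.+ length xs ℕ.* L ≤⟨ ℕ.+-monoˡ-≤ _ (bound C) ⟩
      R ℕ.+ length xs ℕ.* L                     ≤⟨ bound′ ⟩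
      R′                                        ∎
  }
  where open ℕ.≤-Reasoning

unions : {S : A → Pt n → Set} {as : List A} → AllPairs (Apart on S) as →
         All (λ a → Cover Good (S a) L R) as →
         Cover Good (λ x → Any (λ a → S a x) as) L (length as ℕ.* R)
unions []       []       = all-rest [] λ _ ()
unions (a# ∷ #) (C ∷ Cs) = extend []
  (λ _ → λ { (here Sx) → inj₁ (inj₁ Sx) ; (there Sx) → inj₁ (inj₂ Sx) })
  (λ _ → [ here , there ]′)
  (ℕ.≤-reflexive (ℕ.+-identityʳ _))
  (union (λ x y Sx any → let b# , Sy = All.lookupAny a# any in b# x y Sx Sy) C (unions # Cs))

push : (f : Pt m → Pt n) → (∀ {x y} → x ≗ y → f x ≗ f y) → (∀ {x y} → f x ≗ f y → x ≗ y) →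
       (φ : HJ m l → HJ n l) → (∀ V y → embed (φ V) y ≗ f (embed V y)) →
       (∀ V → Good V → Good′ (φ V)) →
       Cover Good S L R → Cover Good′ (λ x → ∃ λ y → S y × f y ≗ x) L R
push {Good = Good} {Good′ = Good′} {S = S} {L = L} {R} f f-cong f-injective φ embed-φ good-φ C = record
  { tiles    = map φ (tiles C)
  ; good     = Allₚ.map⁺ (All.map (good-φ _) (good C))
  ; inside   = Allₚ.map⁺ (All.map (λ {V} V⊆S y → embed V y , V⊆S y , λ e → sym (embed-φ V y e)) (inside C))
  ; disjoint = AllPairsₚ.map⁺ (AllPairs.map (λ {V} {W} V#W x y h → V#W x y
      (f-injective λ e → trans (sym (embed-φ V x e)) (trans (h e) (embed-φ W y e)))) (disjoint C))
  ; rest     = map f (rest C)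
  ; total    = λ x (y , Sy , fy≗x) → Sum.map
      (λ any → Anyₚ.map⁺ (Any.map (λ {V} (u , Vu≗y) → u , λ e →
        trans (embed-φ V u e) (trans (f-cong Vu≗y e) (fy≗x e))) any))
      (λ any → Anyₚ.map⁺ (Any.map (λ z≗y e → trans (f-cong z≗y e) (fy≗x e)) any))
      (total C y Sy)
  ; bound    = subst (λ r → r ℕ.* L ℕ.≤ R) (sym (length-map f (rest C))) (bound C)
  }

Everything : Pt n → Set
Everything = const ⊤

-- Every tile is replaced by a covering of itself. The number of tiles in the bound is later
-- absorbed by `packing`.
refine : {Good : HJ n m → Set} {Good′ : HJ n l → Set} (C : Cover Good Everything L R) →
         (∀ V → Good V → Cover Good′ (_∈ V) L R′) →
         Cover Good′ Everything L (length (tiles C) ℕ.* R′ ℕ.+ R)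
refine C inner = extend (rest C) (λ x _ → total C x tt) (λ _ _ → tt) (ℕ.+-monoʳ-≤ _ (bound C))
  (unions (AllPairs.map (λ {V} {W} → separate-distinct {V = V} {W}) (disjoint C)) (All.map (inner _) (good C)))

length-cartesianProductWith : (f : A → B → A′) (xs : List A) (ys : List B) →
                              length (cartesianProductWith f xs ys) ≡ length xs ℕ.* length ys
length-cartesianProductWith f []       ys = refl
length-cartesianProductWith f (x ∷ xs) ys = trans (length-++ (map (f x) ys))
  (cong₂ ℕ._+_ (length-map (f x) ys) (length-cartesianProductWith f xs ys))

∈? : (V : HJ n m) (x : Pt n) → Dec (x ∈ V)
∈? {n} {m} V x = map′ Any.satisfied
  (λ (y , Vy≗x) → Any.map (λ y′≗y e → trans (embed-cong V y′≗y e) (Vy≗x e)) (points-complete (Edge-↔-Fin m) y))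
  (Any.any? (λ y → ≗-dec (Edge-↔-Fin n) (embed V y) x) (points (Edge-↔-Fin m)))

-- Covering the product of the first coordinates with a subspace

slice : (Fin M × Fin N → Bool) → Poly (Edge (M ℕ.+ N)) d → Poly (Edge M ⊎ Edge N) d
slice {M} w p = p ⟨ [ inj₂ ∘ inj₁ , [ inj₁ ∘ w , inj₂ ∘ inj₂ ]′ ]′ ∘ part M ⟩

⟦slice⟧ : (w : Fin M × Fin N → Bool) (p : Poly (Edge (M ℕ.+ N)) d) (z : Pt M) (y : Pt N) →
          ⟦ slice w p ⟧ [ z , y ]′ ≡ ⟦ p ⟧ (assemble z w y)
⟦slice⟧ {M} w p z y = trans (⟦⟨⟩⟧ p _ [ z , y ]′) (⟦⟧-cong p (pointwise ∘ part M))
  where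
  pointwise : [ id , [ z , y ]′ ]′ ∘ [ inj₂ ∘ inj₁ , [ inj₁ ∘ w , inj₂ ∘ inj₂ ]′ ]′ ≗ [ z , [ w , y ]′ ]′
  pointwise (inj₁ _)        = refl
  pointwise (inj₂ (inj₁ _)) = refl
  pointwise (inj₂ (inj₂ _)) = refl

module _ (p : Poly (Edge (M ℕ.+ N)) (suc d)) (w : Fin M × Fin N → Bool) (V : HJ N n) where

  -- Once all `diff z` are constant on `V`, the value at (z, embed V y) is `first-poly` at z plus
  -- `second-poly` at y minus a constant, modulo 2^k.
  first-poly : Poly (Edge M) (suc d)
  first-poly = slice w p ⟨ [ inj₂ , inj₁ ∘ embed V zeros ]′ ⟩

  second-poly : Poly (Edge n) (suc d)
  second-poly = slice w p ⟨ [ const (inj₁ false) , coordinates V ]′ ⟩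

  ⟦first-poly⟧ : ∀ z → ⟦ first-poly ⟧ z ≡ ⟦ slice w p ⟧ [ z , embed V zeros ]′
  ⟦first-poly⟧ z = trans (⟦⟨⟩⟧ (slice w p) _ z) (⟦⟧-cong (slice w p) λ { (inj₁ _) → refl ; (inj₂ _) → refl })

  ⟦second-poly⟧ : ∀ y → ⟦ second-poly ⟧ y ≡ ⟦ slice w p ⟧ [ zeros , embed V y ]′
  ⟦second-poly⟧ y = trans (⟦⟨⟩⟧ (slice w p) _ y) (⟦⟧-cong (slice w p) λ { (inj₁ _) → refl ; (inj₂ _) → refl })

  -- On U the first summand of the separated polynomial is constant, so U × {y} is a tile for every y;
  -- for z outside U the tiles of {z} come from the second summand.
  cover-product : (∀ z → ConstantOn k (diff z (slice w p)) V) →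
                  (U : HJ M m) → ConstantOn k first-poly U →
                  Cover (ConstantOn {d = suc d} {m = m} k second-poly) Everything L R →
                  Cover (ConstantOn {d = suc d} {m = m} k p) (λ x → ∃₂ λ z y → assemble z w (embed V y) ≗ x)
                    L ((2 ^ numEdges M ∸ 1) ℕ.* R)
  cover-product {k} {m} {L} {R} separated U U-constant 𝒲 =
    extend [] (λ x → inj₁ ∘ covered x) inside-region total-bound (union left#right left-cover right-cover)
    where
    q = slice w p

    swap : ∀ z x y → ⟦ q ⟧ [ z , embed V x ]′ ℤ.+ ⟦ q ⟧ [ zeros , embed V y ]′ ≡
                     ⟦ q ⟧ [ z , embed V y ]′ ℤ.+ ⟦ q ⟧ [ zeros , embed V x ]′ mod2^ k
    swap z x y = exchange q z (embed V x) (embed V y) (separated z x y)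

    value : ∀ z y {x} → x ≗ assemble z w y → ⟦ q ⟧ [ z , y ]′ ≡ ⟦ p ⟧ x
    value z y h = trans (⟦slice⟧ w p z y) (⟦⟧-cong p (sym ∘ h))

    -- Passing from `y` to `zeros` by `swap` changes the value by the same term for all points of
    -- `U`, so constancy of `first-poly` on `U` suffices.
    left-constant : ∀ y → ConstantOn k p (left U w (embed V y))
    left-constant y a b = subst₂ (_≡_mod2^ k)
      (value (embed U a) (embed V y) (embed-left U w (embed V y) a))
      (value (embed U b) (embed V y) (embed-left U w (embed V y) b))
      (mod-cancel (mod-trans (swap (embed U a) y zeros)
        (mod-trans (mod-+ (subst₂ (_≡_mod2^ k) (⟦first-poly⟧ (embed U a)) (⟦first-poly⟧ (embed U b)) (U-constant a b))
                          (mod-reflexive refl))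
          (mod-sym (swap (embed U b) y zeros)))))

    right-constant : ∀ z (W : HJ n m) → ConstantOn k second-poly W → ConstantOn k p (right z w (V ∘ʰ W))
    right-constant z W W-constant a b = subst₂ (_≡_mod2^ k)
      (value z (embed V (embed W a)) (along a)) (value z (embed V (embed W b)) (along b))
      (mod-cancel (mod-trans (mod-+ (mod-reflexive {a = ⟦ q ⟧ [ z , embed V (embed W a) ]′} refl)
        (subst₂ (_≡_mod2^ k) (⟦second-poly⟧ (embed W a)) (⟦second-poly⟧ (embed W b)) (W-constant a b)))
        (swap z (embed W a) (embed W b))))
      where
      along : ∀ a → embed (right z w (V ∘ʰ W)) a ≗ assemble z w (embed V (embed W a))
      along a e = trans (embed-right z w (V ∘ʰ W) a e)
        (assemble-cong {z = z} {w = w} (λ _ → refl) (λ _ → refl) (embed-∘ V W a) e)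

    Left Right : Pt (M ℕ.+ N) → Set
    Left  x = Any (λ y → x ∈ left U w (embed V y)) (points (Edge-↔-Fin n))
    Right x = Any (λ z → ∃ λ y → ⊤ × assemble z w (embed V y) ≗ x)
                  (filter (¬? ∘ ∈? U) (points (Edge-↔-Fin M)))

    left-cover : Cover (ConstantOn k p) Left L (length (points (Edge-↔-Fin n)) ℕ.* 0)
    left-cover = unions
      (AllPairs.map (λ {y} {y′} y≠y′ _ _ (a , h) (b , h′) x≗x′ → y≠y′ (embed-injective V (proj₂ (proj₂
        (assemble-injective {z = embed U a} {z′ = embed U b} λ e → trans (sym (embed-left U w (embed V y) a e))
        (trans (h e) (trans (x≗x′ e) (trans (sym (h′ e)) (embed-left U w (embed V y′) b e)))))))))
        (points-distinct (Edge-↔-Fin n)))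
      (All.universal (λ y → singleton (left U w (embed V y)) (left-constant y)) _)

    right-cover : Cover (ConstantOn k p) Right L (length (filter (¬? ∘ ∈? U) (points (Edge-↔-Fin M))) ℕ.* R)
    right-cover = unions
      (AllPairsₚ.filter⁺ (¬? ∘ ∈? U) (AllPairs.map (λ {z} {z′} z≠z′ _ _ (a , _ , h) (b , _ , h′) x≗x′ →
        z≠z′ (proj₁ (assemble-injective λ e → trans (h e) (trans (x≗x′ e) (sym (h′ e))))))
        (points-distinct (Edge-↔-Fin M))))
      (All.universal (λ z → push (assemble z w ∘ embed V)
        (λ h → assemble-cong {z = z} {w = w} (λ _ → refl) (λ _ → refl) (embed-cong V h))
        (λ h → embed-injective V (proj₂ (proj₂ (assemble-injective {z = z} {z} {w} {w} h))))
        (λ W → right z w (V ∘ʰ W))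
        (λ W a e → trans (embed-right z w (V ∘ʰ W) a e)
          (assemble-cong {z = z} {w = w} (λ _ → refl) (λ _ → refl) (embed-∘ V W a) e))
        (right-constant z) 𝒲) _)

    left#right : Apart Left Right
    left#right x y Lx Ry x≗y with Any.satisfied Lx
    ... | u , a , h with All.lookupAny (Allₚ.all-filter (¬? ∘ ∈? U) (points (Edge-↔-Fin M))) Ry
    ...   | z∉U , b , _ , h′ = z∉U (a , proj₁ (assemble-injective λ e →
      trans (sym (embed-left U w (embed V u) a e)) (trans (h e) (trans (x≗y e) (sym (h′ e))))))

    covered : ∀ x → (∃₂ λ z y → assemble z w (embed V y) ≗ x) → Left x ⊎ Right x
    covered x (z , y , h) with ∈? U z
    ... | yes (a , Ua≗z) = inj₁ (Any.map (λ {y′} y′≗y → a , λ e →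
      trans (embed-left U w (embed V y′) a e)
        (trans (assemble-cong {w = w} Ua≗z (λ _ → refl) (embed-cong V y′≗y) e) (h e)))
      (points-complete (Edge-↔-Fin n) y))
    ... | no z∉U = inj₂ (outside (Anyₚ.filter⁺ (¬? ∘ ∈? U) (points-complete (Edge-↔-Fin M) z)))
      where
      outside : _ → Right x
      outside (inj₁ any) = Any.map (λ z′≗z → y , tt , λ e →
        trans (assemble-cong {w = w} {y = embed V y} z′≗z (λ _ → refl) (λ _ → refl) e) (h e)) any
      outside (inj₂ ¬¬z∈U) with decidable-stable (∈? U _) ¬¬z∈U
      ... | a , Ua≗z′ = contradiction (a , λ e → trans (Ua≗z′ e)
        (Anyₚ.lookup-result (points-complete (Edge-↔-Fin M) z) e)) z∉U

    inside-region : ∀ x → Left x ⊎ Right x → ∃₂ λ z y → assemble z w (embed V y) ≗ x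
    inside-region x (inj₁ Lx) with Any.satisfied Lx
    ... | y , a , h = embed U a , y , λ e → trans (sym (embed-left U w (embed V y) a e)) (h e)
    inside-region x (inj₂ Rx) with Any.satisfied Rx
    ... | z , y , _ , h = z , y , h

    total-bound : length (points (Edge-↔-Fin n)) ℕ.* 0 ℕ.+
      length (filter (¬? ∘ ∈? U) (points (Edge-↔-Fin M))) ℕ.* R ℕ.+ 0 ℕ.≤ (2 ^ numEdges M ∸ 1) ℕ.* R
    total-bound = begin
      length (points (Edge-↔-Fin n)) ℕ.* 0 ℕ.+ few ℕ.* R ℕ.+ 0
        ≡⟨ ℕ.+-identityʳ _ ⟩
      length (points (Edge-↔-Fin n)) ℕ.* 0 ℕ.+ few ℕ.* R
        ≡⟨ cong (ℕ._+ few ℕ.* R) (ℕ.*-zeroʳ (length (points (Edge-↔-Fin n)))) ⟩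
      few ℕ.* R
        ≤⟨ ℕ.*-monoˡ-≤ R (ℕ.∸-monoˡ-≤ 1 few<all) ⟩
      (2 ^ numEdges M ∸ 1) ℕ.* R                             ∎
      where
      open ℕ.≤-Reasoning
      few : ℕ
      few = length (filter (¬? ∘ ∈? U) (points (Edge-↔-Fin M)))
      -- `U` contains `embed U zeros`, so at least one value of z causes no loss. This is the whole
      -- gain of a round.
      few<all : few ℕ.< 2 ^ numEdges M
      few<all = subst (few ℕ.<_) (length-points (Edge-↔-Fin M)) (filter-notAll (¬? ∘ ∈? U) _
        (Any.map (λ h ¬∈ → ¬∈ (zeros , sym ∘ h)) (points-complete (Edge-↔-Fin M) (embed U zeros))))

-- Densities of coverings and the induction on the degree

weaken : (∀ V → Good V → Good′ V) → R ℕ.≤ R′ → Cover Good S L R → Cover Good′ S L R′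
weaken good⇒ R≤R′ C = record
  { tiles    = tiles C
  ; good     = All.map (good⇒ _) (good C)
  ; inside   = inside C
  ; disjoint = disjoint C
  ; rest     = rest C
  ; total    = total C
  ; bound    = ℕ.≤-trans (bound C) R≤R′
  }

rescale : ∀ c .{{_ : ℕ.NonZero c}} → Cover Good S (c ℕ.* L) (c ℕ.* R) → Cover Good S L R
rescale {L = L} {R} c C = record
  { tiles    = tiles C
  ; good     = good C
  ; inside   = inside C
  ; disjoint = disjoint C
  ; rest     = rest C
  ; total    = total C
  ; bound    = ℕ.*-cancelˡ-≤ c (subst (ℕ._≤ c ℕ.* R) (lemma (length (rest C)) c L) (bound C))
  }
  where
  lemma : ∀ r c L → r ℕ.* (c ℕ.* L) ≡ c ℕ.* (r ℕ.* L)
  lemma = ℕ-Solver.solve-∀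

Slice : (Fin M × Fin N → Bool) → Pt (M ℕ.+ N) → Set
Slice w x = ∃₂ λ z y → assemble z w y ≗ x

-- The fibres over the 2^(M * N) values of `w` partition the space.
unslice : {Good : HJ (M ℕ.+ N) m → Set} → (∀ w → Cover Good (Slice {M} {N} w) L R) →
          Cover Good Everything L (2 ^ (M ℕ.* N) ℕ.* R)
unslice {M} {N} {R = R} C = extend []
  (λ x _ → inj₁ (Any.map (λ w≗ → _ , _ , λ e → trans (assemble-cong {M} (λ _ → refl) w≗ (λ _ → refl) e)
    (disassemble M x e)) (points-complete ϕ _)))
  (λ _ _ → tt)
  (ℕ.≤-reflexive (trans (ℕ.+-identityʳ _) (cong (ℕ._* R) (length-points ϕ))))
  (unions (AllPairs.map (λ w≠w′ _ _ (_ , _ , h) (_ , _ , h′) x≗x′ → w≠w′ (proj₁ (proj₂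
      (assemble-injective {M} {N} λ e → trans (h e) (trans (x≗x′ e) (sym (h′ e)))))))
      (points-distinct ϕ))
    (All.universal C _))
  where
  ϕ : (Fin M × Fin N) ↔ Fin (M ℕ.* N)
  ϕ = ↔-sym *↔×

-- The uncovered proportion is at most s / L. Keeping `L` fixed and lowering `s` by one per round
-- replaces estimates with powers of a ratio.
Coverable : (d k m L s : ℕ) → Set
Coverable d k m L s = ∃ λ n₀ → ∀ n → n₀ ℕ.≤ n → (p : Poly (Edge n) d) →
  Cover (ConstantOn {m = m} k p) Everything L (s ℕ.* 2 ^ numEdges n)

ListCoverable : {A : Set} (d k : ℕ) (as : List A) (m L : ℕ) → Set
ListCoverable {A} d k as m L = ∃ λ n₀ → ∀ n → n₀ ℕ.≤ n → (p : A → Poly (Edge n) d) →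
  Cover {m = m} (λ V → All (λ a → ConstantOn k (p a) V) as) Everything L (2 ^ numEdges n)

restrict : (V : HJ n m) → Poly (Edge n) d → Poly (Edge m) d
restrict V p = p ⟨ coordinates V ⟩

constant-∘ : (V : HJ n m) (W : HJ m l) (p : Poly (Edge n) d) →
             ConstantOn k (restrict V p) W → ConstantOn k p (V ∘ʰ W)
constant-∘ V W p h x y = subst₂ (_≡_mod2^ _) (value x) (value y) (h x y)
  where
  value : ∀ x → ⟦ restrict V p ⟧ (embed W x) ≡ ⟦ p ⟧ (embed (V ∘ʰ W) x)
  value x = trans (⟦⟨⟩⟧ p (coordinates V) (embed W x)) (⟦⟧-cong p (sym ∘ embed-∘ V W x))

constant-outer : (V : HJ n m) (W : HJ m l) (p : Poly (Edge n) d) →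
                 ConstantOn k p V → ConstantOn k p (V ∘ʰ W)
constant-outer V W p h x y = subst₂ (_≡_mod2^ _)
  (⟦⟧-cong p (sym ∘ embed-∘ V W x)) (⟦⟧-cong p (sym ∘ embed-∘ V W y)) (h (embed W x) (embed W y))

-- Tiles of dimension `n₁` for the first polynomial are covered again for the restrictions of the
-- others. Each of the two levels may lose a proportion 1 / (2L); for the inner one this follows
-- from `packing`.
cover-list : (∀ m L → Coverable d k m L 1) → (as : List A) → ∀ m L → ListCoverable d k as m L
cover-list coverable [] m L with coverable m L
... | n₀ , cover = n₀ , λ n n≥n₀ _ →
  -- With no polynomial to respect, the covering for the zero polynomial serves.
  weaken (λ _ _ → []) (ℕ.≤-reflexive (ℕ.*-identityˡ _)) (cover n n≥n₀ (con 0ℤ))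
cover-list {d} {k} {A} coverable (a ∷ as) m L with cover-list coverable as m (2 ℕ.* L)
... | n₁ , cover-as with coverable n₁ (2 ℕ.* L)
...   | n₀ , cover-a = n₀ , λ n n≥n₀ p → rescale 2 (weaken (λ _ h → h) (bound′ n (cover-a n n≥n₀ (p a)))
    (refine (cover-a n n≥n₀ (p a)) (inner n p)))
  where
  inner : ∀ n (p : A → Poly (Edge n) d) (V : HJ n n₁) → ConstantOn k (p a) V →
          Cover (λ W → All (λ b → ConstantOn k (p b) W) (a ∷ as)) (_∈ V) (2 ℕ.* L) (2 ^ numEdges n₁)
  inner n p V V-constant = extend []
    (λ _ (y , h) → inj₁ (y , tt , h)) (λ _ (y , _ , h) → y , h) (ℕ.≤-reflexive (ℕ.+-identityʳ _))
    (push (embed V) (embed-cong V) (embed-injective V) (V ∘ʰ_) (embed-∘ V)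
      (λ W W-constant → constant-outer V W (p a) V-constant ∷ All.map (λ {b} → constant-∘ V W (p b)) W-constant)
      (cover-as n₁ ℕ.≤-refl (restrict V ∘ p)))

  bound′ : ∀ n {Good : HJ n n₁ → Set} (C : Cover Good Everything (2 ℕ.* L) (1 ℕ.* 2 ^ numEdges n)) →
           length (tiles C) ℕ.* 2 ^ numEdges n₁ ℕ.+ 1 ℕ.* 2 ^ numEdges n ℕ.≤ 2 ℕ.* 2 ^ numEdges n
  bound′ n C = begin
    length (tiles C) ℕ.* 2 ^ numEdges n₁ ℕ.+ 1 ℕ.* 2 ^ numEdges n
      ≤⟨ ℕ.+-monoˡ-≤ _ (packing (disjoint C)) ⟩
    2 ^ numEdges n ℕ.+ 1 ℕ.* 2 ^ numEdges n
      ∎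
    where open ℕ.≤-Reasoning

-- Every polynomial is constant, so freezing all edges not inside the first `m` vertices gives an
-- exact partition.
cover-degree-0 : ∀ m L → Coverable 0 k m L 1
cover-degree-0 {k} m L = m , λ n m≤n → subst
  (λ n → (p : Poly (Edge n) 0) → Cover (ConstantOn k p) Everything L (1 ℕ.* 2 ^ numEdges n))
  (ℕ.m+[n∸m]≡n m≤n) (cover (n ∸ m))
  where
  cover : ∀ N (p : Poly (Edge (m ℕ.+ N)) 0) →
          Cover {m = m} (ConstantOn k p) Everything L (1 ℕ.* 2 ^ numEdges (m ℕ.+ N))
  cover N p = weaken (λ _ h → h) (ℕ.≤-trans (ℕ.≤-reflexive (ℕ.*-zeroʳ (2 ^ (m ℕ.* N)))) z≤n) (unslice fibre)
    where
    fibre : ∀ w → Cover {m = m} (ConstantOn k p) (Slice {m} {N} w) L 0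
    fibre w = extend []
      (λ x (z , y , h) → inj₁ (Any.map (λ {y′} y′≗y → z , λ e → trans (embed-left idʰ w y′ z e)
        (trans (assemble-cong {w = w} (identity z) (λ _ → refl) y′≗y e) (h e))) (points-complete (Edge-↔-Fin N) y)))
      (λ x any → let y , z , h = Any.satisfied any in z , y , λ e →
        trans (assemble-cong {w = w} {y = y} (sym ∘ identity z) (λ _ → refl) (λ _ → refl) e)
          (trans (sym (embed-left idʰ w y z e)) (h e)))
      (ℕ.≤-reflexive (trans (ℕ.+-identityʳ _) (ℕ.*-zeroʳ (length (points (Edge-↔-Fin N))))))
      (unions (AllPairs.map (λ {y} {y′} y≠y′ _ _ (a , h) (b , h′) x≗x′ → y≠y′ (proj₂ (proj₂
          (assemble-injective {z = embed idʰ a} {z′ = embed idʰ b} λ e → trans (sym (embed-left idʰ w y a e))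
          (trans (h e) (trans (x≗x′ e) (trans (sym (h′ e)) (embed-left idʰ w y′ b e))))))))
          (points-distinct (Edge-↔-Fin N)))
        (All.universal (λ y → singleton (left idʰ w y) λ a b → mod-reflexive (⟦⟧-degree-0 p _ _)) _))
      where
      identity : ∀ z → embed (idʰ {m}) z ≗ z
      identity z e = cong z (pair-η e)

-- Here `t` tiles of size `H` and `r` lost points lie in a space of size `G`, and z takes `D`
-- values. In units of 1 / L the tiles lose at most (D - 1)(s + 1)G and the lost points at most DG;
-- the sum is at most sDG because 2D is at most s + 1.
improvement : ∀ {t r D s G H} → t ℕ.* H ℕ.≤ G → r ℕ.* L ℕ.≤ G → 2 ℕ.* D ℕ.≤ suc s → 1 ℕ.≤ D →
              t ℕ.* ((D ∸ 1) ℕ.* (suc s ℕ.* H)) ℕ.+ D ℕ.* r ℕ.* L ℕ.≤ s ℕ.* (D ℕ.* G)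
improvement {L} {t} {r} {suc D} {s} {G} {H} tH≤G rL≤G 2D≤ _ = begin
  t ℕ.* (D ℕ.* (suc s ℕ.* H)) ℕ.+ suc D ℕ.* r ℕ.* L  ≡⟨ regroup t r D s H L ⟩
  D ℕ.* suc s ℕ.* (t ℕ.* H) ℕ.+ suc D ℕ.* (r ℕ.* L)
    ≤⟨ ℕ.+-mono-≤ (ℕ.*-monoʳ-≤ (D ℕ.* suc s) tH≤G) (ℕ.*-monoʳ-≤ (suc D) rL≤G) ⟩
  D ℕ.* suc s ℕ.* G ℕ.+ suc D ℕ.* G                  ≡⟨ collect D s G ⟩
  (s ℕ.* D ℕ.+ (D ℕ.+ (D ℕ.+ 1))) ℕ.* G
    ≤⟨ ℕ.*-monoˡ-≤ G (ℕ.+-monoʳ-≤ (s ℕ.* D) (ℕ.s≤s⁻¹ (subst (ℕ._≤ suc s) (double D) 2D≤))) ⟩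
  (s ℕ.* D ℕ.+ s) ℕ.* G                               ≡⟨ finish s D G ⟩
  s ℕ.* (suc D ℕ.* G)                                 ∎
  where
  open ℕ.≤-Reasoning
  regroup : ∀ t r D s H L →
    t ℕ.* (D ℕ.* (suc s ℕ.* H)) ℕ.+ suc D ℕ.* r ℕ.* L ≡ D ℕ.* suc s ℕ.* (t ℕ.* H) ℕ.+ suc D ℕ.* (r ℕ.* L)
  regroup = ℕ-Solver.solve-∀
  collect : ∀ D s G → D ℕ.* suc s ℕ.* G ℕ.+ suc D ℕ.* G ≡ (s ℕ.* D ℕ.+ (D ℕ.+ (D ℕ.+ 1))) ℕ.* G
  collect = ℕ-Solver.solve-∀
  double : ∀ D → 2 ℕ.* suc D ≡ suc (D ℕ.+ (D ℕ.+ 1))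
  double = ℕ-Solver.solve-∀
  finish : ∀ s D G → (s ℕ.* D ℕ.+ s) ℕ.* G ≡ s ℕ.* (suc D ℕ.* G)
  finish = ℕ-Solver.solve-∀

-- One round. For each `w`, the y-space is covered by subspaces of dimension `n₁` on which all
-- differences are constant, and over each of them `cover-product` uses the previous covering. The
-- first part has the same `M` vertices in every round.
improve : (∀ {A : Set} (as : List A) m L → ListCoverable d k as m L) →
          ((M , _) : ∃ λ M → (p : Poly (Edge M) (suc d)) → ∃ λ (U : HJ M m) → ConstantOn k p U) →
          ∀ s → 2 ℕ.* 2 ^ numEdges M ℕ.≤ suc s →
          Coverable (suc d) k m L (suc s) → Coverable (suc d) k m L s
improve {d} {k} {m} {L} cover-all (M , subspace) s 2D≤ (n₁ , ih) with cover-all (points (Edge-↔-Fin M)) n₁ L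
... | n₀ , outer = n₀ ℕ.+ M , λ n n₀+M≤n →
  subst (λ n → (p : Poly (Edge n) (suc d)) → Cover (ConstantOn k p) Everything L (s ℕ.* 2 ^ numEdges n))
    (ℕ.m+[n∸m]≡n (ℕ.m+n≤o⇒n≤o n₀ n₀+M≤n)) (cover (n ∸ M) (ℕ.m+n≤o⇒m≤o∸n n₀ n₀+M≤n))
  where
  D = 2 ^ numEdges M

  cover : ∀ N → n₀ ℕ.≤ N → (p : Poly (Edge (M ℕ.+ N)) (suc d)) →
          Cover {m = m} (ConstantOn k p) Everything L (s ℕ.* 2 ^ numEdges (M ℕ.+ N))
  cover N n₀≤N p = weaken (λ _ h → h) (ℕ.≤-reflexive size) (unslice fibre)
    where
    size : 2 ^ (M ℕ.* N) ℕ.* (s ℕ.* (D ℕ.* 2 ^ numEdges N)) ≡ s ℕ.* 2 ^ numEdges (M ℕ.+ N)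
    size = begin
      2 ^ (M ℕ.* N) ℕ.* (s ℕ.* (D ℕ.* 2 ^ numEdges N))
        ≡⟨ lemma (2 ^ (M ℕ.* N)) s D (2 ^ numEdges N) ⟩
      s ℕ.* (D ℕ.* (2 ^ (M ℕ.* N) ℕ.* 2 ^ numEdges N))
        ≡⟨ cong (λ c → s ℕ.* (D ℕ.* c)) (sym (ℕ.^-distribˡ-+-* 2 (M ℕ.* N) (numEdges N))) ⟩
      s ℕ.* (D ℕ.* 2 ^ (M ℕ.* N ℕ.+ numEdges N))
        ≡⟨ cong (s ℕ.*_) (sym (ℕ.^-distribˡ-+-* 2 (numEdges M) (M ℕ.* N ℕ.+ numEdges N))) ⟩
      s ℕ.* 2 ^ (numEdges M ℕ.+ (M ℕ.* N ℕ.+ numEdges N))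
        ≡⟨ cong (λ e → s ℕ.* 2 ^ e) (sym (numEdges-+ M N)) ⟩
      s ℕ.* 2 ^ numEdges (M ℕ.+ N) ∎
      where
      open ≡-Reasoning
      lemma : ∀ c s D G → c ℕ.* (s ℕ.* (D ℕ.* G)) ≡ s ℕ.* (D ℕ.* (c ℕ.* G))
      lemma = ℕ-Solver.solve-∀

    fibre : ∀ w → Cover {m = m} (ConstantOn k p) (Slice {M} {N} w) L (s ℕ.* (D ℕ.* 2 ^ numEdges N))
    fibre w = extend lost split-slice inside-slice bound′
      (unions (AllPairs.map (λ V#W _ _ (_ , y , h) (_ , y′ , h′) x≗x′ → V#W y y′ (proj₂ (proj₂
          (assemble-injective {M} {N} {w = w} {w′ = w} λ e → trans (h e) (trans (x≗x′ e) (sym (h′ e))))))) (disjoint 𝒱))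
        (All.map (λ {V} → product V) (good 𝒱)))
      where
      𝒱 : Cover {m = n₁} (λ V → All (λ z → ConstantOn k (diff z (slice w p)) V) (points (Edge-↔-Fin M)))
                Everything L (2 ^ numEdges N)
      𝒱 = outer N n₀≤N (λ z → diff z (slice w p))

      Region : HJ N n₁ → Pt (M ℕ.+ N) → Set
      Region V x = ∃₂ λ z y → assemble z w (embed V y) ≗ x

      product : ∀ V → All (λ z → ConstantOn k (diff z (slice w p)) V) (points (Edge-↔-Fin M)) →
                Cover (ConstantOn k p) (Region V) L ((D ∸ 1) ℕ.* (suc s ℕ.* 2 ^ numEdges n₁))
      product V V-constant with subspace (first-poly p w V)
      ... | U , U-constant = cover-product p w V all-constant U U-constant (ih n₁ ℕ.≤-refl (second-poly p w V))
        where
        all-constant : ∀ z → ConstantOn k (diff z (slice w p)) V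
        all-constant = points-all (Edge-↔-Fin M) (λ h c x y → subst₂ (_≡_mod2^ k)
          (⟦diff⟧-cong h (slice w p) (embed V x)) (⟦diff⟧-cong h (slice w p) (embed V y)) (c x y)) V-constant

      -- Points whose y-part escapes the outer covering are given up for every z.
      lost : List (Pt (M ℕ.+ N))
      lost = cartesianProductWith (λ z y → assemble z w y) (points (Edge-↔-Fin M)) (rest 𝒱)

      split-slice : ∀ x → Slice w x → Any (λ V → Region V x) (tiles 𝒱) ⊎ Any (_≗ x) lost
      split-slice x (z , y , h) = Sum.map
        (Any.map λ (u , Vu≗y) → z , u , λ e →
          trans (assemble-cong {z = z} {w = w} (λ _ → refl) (λ _ → refl) Vu≗y e) (h e))
        (λ any → Anyₚ.cartesianProductWith⁺ (λ z y → assemble z w y)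
          (λ z′≗z y′≗y e → trans (assemble-cong {w = w} z′≗z (λ _ → refl) y′≗y e) (h e))
          (points-complete (Edge-↔-Fin M) z) any)
        (total 𝒱 y tt)

      inside-slice : ∀ x → Any (λ V → Region V x) (tiles 𝒱) → Slice w x
      inside-slice x any = let V , z , y , h = Any.satisfied any in z , embed V y , h

      bound′ : length (tiles 𝒱) ℕ.* ((D ∸ 1) ℕ.* (suc s ℕ.* 2 ^ numEdges n₁)) ℕ.+ length lost ℕ.* L ℕ.≤
               s ℕ.* (D ℕ.* 2 ^ numEdges N)
      bound′ = subst
        (λ c → length (tiles 𝒱) ℕ.* ((D ∸ 1) ℕ.* (suc s ℕ.* 2 ^ numEdges n₁)) ℕ.+ c ℕ.* L ℕ.≤ s ℕ.* (D ℕ.* 2 ^ numEdges N))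
        (sym (trans (length-cartesianProductWith (λ z y → assemble z w y) (points (Edge-↔-Fin M)) (rest 𝒱))
          (cong (ℕ._* length (rest 𝒱)) (length-points (Edge-↔-Fin M)))))
        (improvement {t = length (tiles 𝒱)} {length (rest 𝒱)} (packing (disjoint 𝒱)) (bound 𝒱) 2D≤ (ℕ.m^n>0 2 (numEdges M)))

-- Proportions are measured over 2D * L. The rounds start at s = 2D + 2D * L with no tiles at all
-- and stop at s = 2D, still within the range of `improve`; there the proportion is 1 / L.
coverable : ∀ d m L → Coverable d k m L 1
coverable zero    m L = cover-degree-0 m L
coverable {k} (suc d) m L with constant-subspace (suc d) k m
... | M , subspace = proj₁ final , λ n n≥n₀ p →
  rescale 2D {{ℕ.m*n≢0 2 (2 ^ numEdges M) {{_}} {{ℕ.m^n≢0 2 (numEdges M)}}}}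
    (weaken (λ _ h → h) (ℕ.≤-reflexive (cong (2D ℕ.*_) (sym (ℕ.*-identityˡ _)))) (proj₂ final n n≥n₀ p))
  where
  2D = 2 ℕ.* 2 ^ numEdges M

  descend : ∀ j → Coverable (suc d) k m (2D ℕ.* L) (2D ℕ.+ j) → Coverable (suc d) k m (2D ℕ.* L) 2D
  descend zero    C = subst (Coverable (suc d) k m (2D ℕ.* L)) (ℕ.+-identityʳ 2D) C
  descend (suc j) C = descend j (improve (cover-list (coverable d)) (M , subspace) (2D ℕ.+ j)
    (ℕ.m≤n⇒m≤1+n (ℕ.m≤m+n 2D j)) (subst (Coverable (suc d) k m (2D ℕ.* L)) (ℕ.+-suc 2D j) C))

  start : Coverable (suc d) k m (2D ℕ.* L) (2D ℕ.+ 2D ℕ.* L)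
  start = 0 , λ n _ p → weaken (λ _ h → h) (bound′ n)
    (all-rest (points (Edge-↔-Fin n)) λ x _ → points-complete (Edge-↔-Fin n) x)
    where
    bound′ : ∀ n → length (points (Edge-↔-Fin n)) ℕ.* (2D ℕ.* L) ℕ.≤ (2D ℕ.+ 2D ℕ.* L) ℕ.* 2 ^ numEdges n
    bound′ n = begin
      length (points (Edge-↔-Fin n)) ℕ.* (2D ℕ.* L)  ≡⟨ cong (ℕ._* (2D ℕ.* L)) (length-points (Edge-↔-Fin n)) ⟩
      2 ^ numEdges n ℕ.* (2D ℕ.* L)                 ≡⟨ ℕ.*-comm (2 ^ numEdges n) (2D ℕ.* L) ⟩
      2D ℕ.* L ℕ.* 2 ^ numEdges n                   ≤⟨ ℕ.*-monoˡ-≤ (2 ^ numEdges n) (ℕ.m≤n+m (2D ℕ.* L) 2D) ⟩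
      (2D ℕ.+ 2D ℕ.* L) ℕ.* 2 ^ numEdges n          ∎
      where open ℕ.≤-Reasoning

  final : Coverable (suc d) k m (2D ℕ.* L) 2D
  final = descend (2D ℕ.* L) start

-- The definitions of the statement

foldr-skip : (f : A → B → B) {as : List A} → All (λ a → ∀ b → f a b ≡ b) as → ∀ b → foldr f b as ≡ b
foldr-skip f []         b = refl
foldr-skip f (skip ∷ s) b = trans (skip _) (foldr-skip f s b)

foldr-once : (f : A → B → B) {a₀ : A} {as : List A} → Unique as → a₀ ∈ˡ as →
             (∀ a → a ≢ a₀ → ∀ b → f a b ≡ b) → ∀ b → foldr f b as ≡ f a₀ b
foldr-once f (a₀≢ ∷ _) (here refl) skip b =
  cong (f _) (foldr-skip f (All.map (λ a₀≢a → skip _ (a₀≢a ∘ sym)) a₀≢) b)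
foldr-once f (a≢ ∷ u) (there a₀∈) skip b = trans (skip _ (All.lookup a≢ a₀∈) _) (foldr-once f u a₀∈ skip b)

-- A copy of the summand local to `IdI`, about which lemmas can be stated.
term : (Fin m → Fin n → Bool) → Pt m → Edge n → Fin m → Fin m → Bool
term I x p i j with i Fin.≤? j
... | yes i≤j = x (edge i j i≤j) ∧ bIdx I (edge i j i≤j) p
... | no _    = false

-- The summand in the definition of IdI is local to it; the unifier extracts it here from the fold.
IdI-fold : (I : Fin m → Fin n → Bool) (x : Pt m) (p : Edge n) →
  ∃ λ (f : Fin m → Fin m → Bool → Bool) →
    IdI I x p ≡ foldr (λ i acc → foldr (f i) acc (allFin m)) false (allFin m)
IdI-fold I x p = _ , refl

IdI-step : (I : Fin m → Fin n → Bool) (x : Pt m) (p : Edge n) (i j : Fin m) (b : Bool) →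
           proj₁ (IdI-fold I x p) i j b ≡ term I x p i j xor b
IdI-step I x p i j b with i Fin.≤? j
... | yes _ = refl
... | no _  = refl

IdI-single : (I : Fin m → Fin n → Bool) (x : Pt m) (p : Edge n) (i₀ j₀ : Fin m) →
             (∀ i j → ¬ (i ≡ i₀ × j ≡ j₀) → term I x p i j ≡ false) → IdI I x p ≡ term I x p i₀ j₀
IdI-single {m} I x p i₀ j₀ others = trans (proj₂ (IdI-fold I x p)) (trans
  (foldr-once (λ i acc → foldr (f i) acc (allFin m)) (allFin⁺ m) (∈-allFin i₀)
    (λ i i≢i₀ → foldr-skip (f i) (All.universal (λ j → skip i j (i≢i₀ ∘ proj₁)) (allFin m))) false)
  (trans (foldr-once (f i₀) (allFin⁺ m) (∈-allFin j₀) (λ j j≢j₀ → skip i₀ j (j≢j₀ ∘ proj₂)) false)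
    (trans (IdI-step I x p i₀ j₀ false) (xor-identityʳ _))))
  where
  f = proj₁ (IdI-fold I x p)
  skip : ∀ i j → ¬ (i ≡ i₀ × j ≡ j₀) → ∀ b → f i j b ≡ b
  skip i j ≢ b = trans (IdI-step I x p i j b) (cong (_xor b) (others i j ≢))

IdI-none : (I : Fin m → Fin n → Bool) (x : Pt m) (p : Edge n) →
           (∀ i j → term I x p i j ≡ false) → IdI I x p ≡ false
IdI-none {m} I x p none = trans (proj₂ (IdI-fold I x p))
  (foldr-skip _ (All.universal (λ i → foldr-skip _ (All.universal (λ j b →
    trans (IdI-step I x p i j b) (cong (_xor b) (none i j))) (allFin m))) (allFin m)) false)

reads : Maybe (Fin m) → Fin m → Bool
reads (just j) i = does (j Fin.≟ i)
reads nothing  i = false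

reads-sound : (s : Maybe (Fin m)) (i : Fin m) → reads s i ≡ true → s ≡ just i
reads-sound (just j) i h with j Fin.≟ i
... | yes refl = refl

reads-just : (i : Fin m) → reads (just i) i ≡ true
reads-just i = dec-true (i Fin.≟ i) refl

wildcards : HJ n m → Fin m → Fin n → Bool
wildcards V i a = reads (letter (word V) a) i

-- This is `bIdx` for the wildcard sets, expressed through the letters at the two ends of an edge.
meets : Maybe (Fin m) → Maybe (Fin m) → Fin m → Fin m → Bool
meets s t i j = ((reads s i ∨ reads s j) ∧ (reads t i ∨ reads t j)) ∧
                ((reads s i ∨ reads t i) ∧ (reads s j ∨ reads t j))

-- Both pairs are ordered, so a crosswise match forces all four letters to coincide; any other
-- mismatch leaves one of the four letters unmatched.
meets-only : {i j i₀ j₀ : Fin m} → i Fin.≤ j → i₀ Fin.≤ j₀ → ¬ (i ≡ i₀ × j ≡ j₀) →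
             meets (just i₀) (just j₀) i j ≡ false
meets-only {i = i} {j} {i₀} {j₀} i≤j i₀≤j₀ ≢ with i₀ Fin.≟ i | i₀ Fin.≟ j | j₀ Fin.≟ i | j₀ Fin.≟ j
... | yes refl | _        | _        | yes refl = contradiction (refl , refl) ≢
... | _        | yes refl | yes refl | _        = contradiction (Fin.≤-antisym i≤j i₀≤j₀ , Fin.≤-antisym i₀≤j₀ i≤j) ≢
... | yes _    | no _     | no _     | no _     = refl
... | yes _    | yes _    | no _     | no _     = refl
... | yes _    | no _     | yes _    | no _     = refl
... | no _     | no _     | _        | _        = refl
... | no _     | yes _    | no _     | no _     = refl
... | no _     | yes _    | no _     | yes _    = refl

meets-self : (i j : Fin m) → meets (just i) (just j) i j ≡ true
meets-self i j rewrite reads-just i | reads-just j with does (i Fin.≟ j) | does (j Fin.≟ i)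
... | true  | true  = refl
... | true  | false = refl
... | false | true  = refl
... | false | false = refl

term-meets : (V : HJ n m) (x : Pt m) (p : Edge n) (i j : Fin m) →
  (i Fin.≤ j → meets (letter (word V) (lo p)) (letter (word V) (hi p)) i j ≡ false) →
  term (wildcards V) x p i j ≡ false
term-meets V x p i j h with i Fin.≤? j
... | yes i≤j = trans (cong (x (edge i j i≤j) ∧_) (h i≤j)) (∧-zeroʳ _)
... | no _    = refl

term-self : (V : HJ n m) (x : Pt m) (p : Edge n) {i j : Fin m} (i≤j : i Fin.≤ j) →
  meets (letter (word V) (lo p)) (letter (word V) (hi p)) i j ≡ true →
  term (wildcards V) x p i j ≡ x (edge i j i≤j)
term-self V x p {i} {j} i≤j h with i Fin.≤? j
... | yes q  = trans (cong (x (edge i j q) ∧_) h) (trans (∧-identityʳ _) (cong x (edge-irrelevant q i≤j)))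
... | no i≰j = contradiction i≤j i≰j

meets-nothing : (s : Maybe (Fin m)) (i j : Fin m) → meets s nothing i j ≡ false
meets-nothing s i j = cong (_∧ ((reads s i ∨ false) ∧ (reads s j ∨ false))) (∧-zeroʳ (reads s i ∨ reads s j))

-- Only the summand of the pair of letters at the ends of `p` can survive. Monotonicity puts these
-- letters in the order over which `IdI` sums.
IdI-wildcards : (V : HJ n m) (x : Pt m) (p : Edge n) →
                IdI (wildcards V) x p ≡ [ const false , x ]′ (coordinates V p)
IdI-wildcards V x p with letter (word V) (lo p) in ωlo | letter (word V) (hi p) in ωhi
... | just i  | just j  = trans
  (IdI-single (wildcards V) x p i j λ i′ j′ ≢ → term-meets V x p i′ j′ λ i′≤j′ →
    trans (cong₂ (λ s t → meets s t i′ j′) ωlo ωhi) (meets-only i′≤j′ i≤j ≢))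
  (trans (term-self V x p i≤j (trans (cong₂ (λ s t → meets s t i j) ωlo ωhi) (meets-self i j)))
    (cong x (sym (pair-ordered i≤j))))
  where
  i≤j : i Fin.≤ j
  i≤j = monotone V ωlo ωhi (ord p)
... | just i  | nothing = IdI-none (wildcards V) x p λ i′ j′ → term-meets V x p i′ j′ λ _ →
  trans (cong (λ t → meets (letter (word V) (lo p)) t i′ j′) ωhi) (meets-nothing (letter (word V) (lo p)) i′ j′)
... | nothing | _       = IdI-none (wildcards V) x p λ i′ j′ → term-meets V x p i′ j′ λ _ →
  cong (λ s → meets s (letter (word V) (hi p)) i′ j′) ωlo

toBlockHJ : HJ n m → BlockHJ n m
toBlockHJ {n} {m} V = record
  { I        = wildcards V
  -- Offset bits on edges between wildcard positions are reset to false, as `cVanish` demands.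
  ; c        = [ id , const false ]′ ∘ coordinates V
  ; nonempty = nonempty
  ; disjoint = λ i j a p q → just-injective (trans (sym (sound p)) (sound q))
  ; minOrder = λ i j i<j → let a , p = nonempty i in a , p , λ b q → before i j i<j a b p q
  ; block    = before
  ; cVanish  = λ e (i , p) (j , q) → cong [ id , const false ]′ (cong₂ (code (offset V e)) (sound p) (sound q))
  }
  where
  sound : ∀ {i a} → wildcards V i a ≡ true → letter (word V) a ≡ just i
  sound {i} {a} = reads-sound (letter (word V) a) i
  nonempty : ∀ i → ∃ λ a → wildcards V i a ≡ true
  nonempty i with onto (word V) i
  ... | a , ωa = a , trans (cong (λ s → reads s i) ωa) (reads-just i)
  before : ∀ i j → i Fin.< j → ∀ a b → wildcards V i a ≡ true → wildcards V j b ≡ true → a Fin.< b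
  before i j i<j a b p q = ℕ.≰⇒> λ b≤a → ℕ.<⇒≱ i<j (monotone V (sound q) (sound p) b≤a)

emb-toBlockHJ : (V : HJ n m) (x : Pt m) → emb (toBlockHJ V) x ≗ embed V x
emb-toBlockHJ V x e = trans (cong (_xor [ id , const false ]′ (coordinates V e)) (IdI-wildcards V x e))
  (sum (coordinates V e))
  where
  sum : ∀ s → [ const false , x ]′ s xor [ id , const false ]′ s ≡ [ id , x ]′ s
  sum (inj₁ _) = refl
  sum (inj₂ q) = xor-identityʳ (x q)

-- Integer polynomials, residues and the rational bound

monomial : ℕ → (F : List (Edge n)) → length F ℕ.≤ d → Poly (Edge n) d
monomial c []      _       = con (+ c)
monomial c (e ∷ F) (s≤s h) = e ⊗ monomial c F h

⟦monomial⟧ : ∀ c (F : List (Edge n)) (h : length F ℕ.≤ d) x → ⟦ monomial c F h ⟧ x ≡ + (c ℕ.* prodPt x F)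
⟦monomial⟧ c []      _       x = cong +_ (sym (ℕ.*-identityʳ c))
⟦monomial⟧ c (e ∷ F) (s≤s h) x with x e
... | true  = trans (ℤ.*-identityˡ _) (trans (⟦monomial⟧ c F h x)
  (cong (λ r → + (c ℕ.* r)) (sym (ℕ.*-identityˡ (prodPt x F)))))
... | false = cong +_ (sym (ℕ.*-zeroʳ c))

polynomial : ∀ {n d} → ℕ → (mons : List (ℕ × List (Edge n))) → All (λ { (c , F) → length F ℕ.≤ d }) mons →
             Poly (Edge n) d
polynomial α []               []       = con (+ α)
polynomial α ((c , F) ∷ mons) (h ∷ hs) = monomial c F h ⊕ polynomial α mons hs

⟦polynomial⟧ : ∀ {n d} α (mons : List (ℕ × List (Edge n))) (h : All (λ { (c , F) → length F ℕ.≤ d }) mons) x →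
               ⟦ polynomial α mons h ⟧ x ≡ + evalPoly α mons x
⟦polynomial⟧ α []               []       x = refl
⟦polynomial⟧ α ((c , F) ∷ mons) (h ∷ hs) x = cong₂ ℤ._+_ (⟦monomial⟧ c F h x) (⟦polynomial⟧ α mons hs x)

pos-^ : ∀ k → (+ 2) ℤ.^ k ≡ + (2 ^ k)
pos-^ zero    = refl
pos-^ (suc k) = trans (cong (+ 2 ℤ.*_) (pos-^ k)) (sym (ℤ.pos-* 2 (2 ^ k)))

residue : ℕ → ℕ → ℕ
residue k a = ℕ._%_ a (2 ^ k) {{ℕ.m^n≢0 2 k}}

mod⇒residue : ∀ {a b} → + a ≡ + b mod2^ k → residue k a ≡ residue k b
mod⇒residue {k} {a} {b} (by {quotient} eq) = by-sign quotient eq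
  where
  shift : ∀ {a b} q → + a ≡ (+ b) ℤ.+ + q ℤ.* (+ 2) ℤ.^ k → residue k a ≡ residue k b
  shift {a} {b} q eq = trans
    (cong (residue k) (ℤ.+-injective (trans eq (cong (λ c → (+ b) ℤ.+ c)
      (trans (cong (+ q ℤ.*_) (pos-^ k)) (sym (ℤ.pos-* q (2 ^ k))))))))
    (ℕ.[m+kn]%n≡m%n b q (2 ^ k) {{ℕ.m^n≢0 2 k}})

  lemma : ∀ b q K → b ≡ b ℤ.+ ℤ.- q ℤ.* K ℤ.+ q ℤ.* K
  lemma = ℤ-Solver.solve-∀

  by-sign : ∀ q → + a ≡ (+ b) ℤ.+ q ℤ.* (+ 2) ℤ.^ k → residue k a ≡ residue k b
  by-sign (+ q)    eq = shift q eq
  -- A negative quotient turns positive when `a` and `b` are exchanged.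
  by-sign -[1+ q ] eq = sym (shift (suc q) (trans (lemma (+ b) (+ suc q) ((+ 2) ℤ.^ k))
    (cong (λ c → c ℤ.+ + suc q ℤ.* (+ 2) ℤ.^ k) (sym eq))))

integer-/1 : ∀ a → ℚ.toℚᵘ ((+ a) / 1) ℚᵘ.≃ ℚᵘ.mkℚᵘ (+ a) 0
integer-/1 a = ℚ.toℚᵘ-fromℚᵘ (ℚᵘ.mkℚᵘ (+ a) 0)

-- A positive η has numerator at least 1, so it is at least the reciprocal of its denominator
-- `↧ₙ η`, which is the `L` of the final covering.
scaled-≤ : (η : ℚ) → 0ℚ < η → ∀ a b → a ℕ.* ℚ.↧ₙ η ℕ.≤ b → (+ a) / 1 ≤ η * ((+ b) / 1)
scaled-≤ η@(mkℚ (+ suc r) t _) _ a b h = ℚ.toℚᵘ-cancel-≤ (begin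
  ℚ.toℚᵘ ((+ a) / 1)                        ≃⟨ integer-/1 a ⟩
  ℚᵘ.mkℚᵘ (+ a) 0                           ≤⟨ ℚᵘ.*≤* (subst₂ ℤ._≤_ (ℤ.pos-* a _) product (ℤ.+≤+ large)) ⟩
  ℚ.toℚᵘ η ℚᵘ.* ℚᵘ.mkℚᵘ (+ b) 0             ≃⟨ ℚᵘ.*-congˡ {ℚ.toℚᵘ η} (integer-/1 b) ⟨
  ℚ.toℚᵘ η ℚᵘ.* ℚ.toℚᵘ ((+ b) / 1)          ≃⟨ ℚ.toℚᵘ-homo-* η ((+ b) / 1) ⟨
  ℚ.toℚᵘ (η * ((+ b) / 1))                  ∎)
  where
  open ℚᵘ.≤-Reasoning
  product : + (suc r ℕ.* b) ≡ (+ suc r ℤ.* + b) ℤ.* + 1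
  product = trans (ℤ.pos-* (suc r) b) (sym (ℤ.*-identityʳ _))
  large : a ℕ.* (suc t ℕ.* 1) ℕ.≤ suc r ℕ.* b
  large = ℕ.≤-trans (ℕ.≤-reflexive (cong (a ℕ.*_) (ℕ.*-identityʳ (suc t)))) (ℕ.≤-trans h (ℕ.m≤m+n b (r ℕ.* b)))
scaled-≤ (mkℚ (+ zero) _ _) (*<* (ℤ.+<+ ())) a b h
scaled-≤ (mkℚ -[1+ _ ] _ _) (*<* ()) a b h

point-decSetoid : ℕ → DecSetoid _ _
point-decSetoid n = record
  { Carrier = Pt n
  ; _≈_ = _≗_
  ; isDecEquivalence = record
      { isEquivalence = record
          { refl  = λ _ → refl
          ; sym   = λ h e → sym (h e)
          ; trans = λ h h′ e → trans (h e) (h′ e)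
          }
      ; _≟_ = ≗-dec (Edge-↔-Fin n)
      }
  }

theorem5p5 : (η : ℚ) → 0ℚ < η → (m d : ℕ) → m ≥ 1 → d ≥ 1 →
    Σ ℕ λ n₃ → n₃ ≥ 1 ×
    ((n : ℕ) → n ≥ n₃ → (Q : Pt n → ℕ) → IsIntPoly d d Q →
    Σ (List (BlockHJ n m)) λ 𝒱 →
    AllPairs Disjoint 𝒱 ×
    (Σ (List (Pt n)) λ L →
    AllPairs (λ x y → ¬ (x ≈ₚ y)) L ×
    (∀ x → ¬ Any (λ V → x ∈HJ V) 𝒱 → Any (λ y → y ≈ₚ x) L) ×
    ((+ length L) / 1 ≤ η * ((+ (2 ^ numEdges n)) / 1))) ×
    All (λ V → ∀ x y → Q (emb V x) ≡ Q (emb V y)) 𝒱)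
theorem5p5 η η>0 m d _ _ with coverable {d} d m (ℚ.↧ₙ η)
-- The successor makes the bound positive.
... | n₀ , cover = suc n₀ , s≤s z≤n , covering
  where
  covering : (n : ℕ) → n ≥ suc n₀ → (Q : Pt n → ℕ) → IsIntPoly d d Q →
    Σ (List (BlockHJ n m)) λ 𝒱 →
    AllPairs Disjoint 𝒱 ×
    (Σ (List (Pt n)) λ L →
    AllPairs (λ x y → ¬ (x ≈ₚ y)) L ×
    (∀ x → ¬ Any (λ V → x ∈HJ V) 𝒱 → Any (λ y → y ≈ₚ x) L) ×
    ((+ length L) / 1 ≤ η * ((+ (2 ^ numEdges n)) / 1))) ×
    All (λ V → ∀ x y → Q (emb V x) ≡ Q (emb V y)) 𝒱
  covering n n>n₀ Q (α , mons , degrees , Q≡) =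
    List.map toBlockHJ (tiles C) ,
    AllPairsₚ.map⁺ (AllPairs.map
      (λ {V} {W} V#W x (a , h) (b , h′) → V#W a b λ e → trans (sym (emb-toBlockHJ V a e))
        (trans (h e) (trans (sym (h′ e)) (emb-toBlockHJ W b e)))) (disjoint C)) ,
    -- The uncovered list may repeat points; removing repetitions can only shorten it.
    (deduplicate dec (rest C) ,
     UniqueDec.deduplicate-! (point-decSetoid n) (rest C) ,
     (λ x uncovered → [ (λ any → contradiction (Anyₚ.map⁺ (Any.map
         (λ {V} (y , h) → y , λ e → trans (emb-toBlockHJ V y e) (h e)) any)) uncovered)
       , Anyₚ.deduplicate⁺ dec (λ h y≗x e → trans (h e) (y≗x e)) ]′ (total C x _)) ,
     scaled-≤ η η>0 (length (deduplicate dec (rest C))) (2 ^ numEdges n)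
       (ℕ.≤-trans (ℕ.*-monoˡ-≤ (ℚ.↧ₙ η) (length-deduplicate dec (rest C)))
       (ℕ.≤-trans (bound C) (ℕ.≤-reflexive (ℕ.*-identityˡ _))))) ,
    Allₚ.map⁺ (All.map (λ {V} constant x y → trans (value V x)
      (trans (mod⇒residue (subst₂ (_≡_mod2^ d) (⟦polynomial⟧ α mons degrees (embed V x))
        (⟦polynomial⟧ α mons degrees (embed V y)) (constant x y))) (sym (value V y)))) (good C))
    where
    p : Poly (Edge n) d
    p = polynomial α mons degrees

    C : Cover (ConstantOn d p) Everything (ℚ.↧ₙ η) (1 ℕ.* 2 ^ numEdges n)
    C = cover n (ℕ.<⇒≤ n>n₀) p

    dec = ≗-dec (Edge-↔-Fin n)

    evaluation : ∀ {x y} → x ≗ y → evalPoly α mons x ≡ evalPoly α mons y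
    evaluation {x} {y} h = ℤ.+-injective (trans (sym (⟦polynomial⟧ α mons degrees x))
      (trans (⟦⟧-cong p h) (⟦polynomial⟧ α mons degrees y)))

    value : (V : HJ n m) (x : Pt m) → Q (emb (toBlockHJ V) x) ≡ residue d (evalPoly α mons (embed V x))
    value V x = trans (Q≡ _) (cong (residue d) (evaluation (emb-toBlockHJ V x)))
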